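{- Let $p\geq 3$ be a prime and let $H_p$ be the Heisenberg group over $\mathbb Z_p$, presented as $H_p=\{x^ay^bz^c: 0\leq a,b,c<p\}$ with relations $x^p=y^p=z^p=1$, $xz=zx$, $yz=zy$, $yx=xyz$. For $$F=\sum_{0\leq i,j,k<p}a_{ijk}\,x^iy^jz^k\in\mathbb Z[H_p],\qquad a_{ijk}\in\mathbb Z,$$ let $M_{H_p}(F)=\det\big(a_{gh^{ -1}}\big)_{g,h\in H_p}$ be the group determinant of $H_p$ evaluated at the coefficients of $F$ (where $a_g=a_{ijk}$ for $g=x^iy^jz^k$). Then $$M_{H_p}(F)\equiv F(1,1,1)^{p^3}\pmod{p^3},$$ where $F(1,1,1)=\sum_{i,j,k}a_{ijk}$.
   Context: For a finite group $G=\{g_1,\dots,g_k\}$ and integers $a_g$, the group determinant is $\det(a_{g_ig_j^{ -1}})_{1\le i,j\le k}$. $H_p$ is the group of $3\times3$ upper unitriangular matrices over $\mathbb Z_p$. -}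

module Defs where

open import Data.Nat as ℕ using (ℕ; zero; suc; NonZero)
open import Data.Nat.DivMod using (_mod_)
open import Data.Fin as Fin using (Fin; toℕ; punchIn; remQuot)
open import Data.Integer as ℤ using (ℤ; +_; -_)
open import Data.Product using (_×_; _,_)

sumFin : ∀ n → (Fin n → ℤ) → ℤ
sumFin zero    f = + 0
sumFin (suc n) f = f Fin.zero ℤ.+ sumFin n (λ i → f (Fin.suc i))

det : ∀ n → (Fin n → Fin n → ℤ) → ℤ
det zero    M = + 1
det (suc n) M =
  sumFin (suc n) (λ j →
    ((- + 1) ℤ.^ toℕ j) ℤ.* M Fin.zero j ℤ.* det n (λ r c → M (Fin.suc r) (punchIn j c)))

-- Elements of the Heisenberg group H_p: the triple (a , b , c) stands for x^a y^b z^c,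
-- with 0 ≤ a,b,c < p.
H : ℕ → Set
H p = Fin p × Fin p × Fin p

module _ (p : ℕ) .{{_ : NonZero p}} where

  -- Multiplication from the relations x^p = y^p = z^p = 1, z central, yx = xyz:
  -- x^a y^b z^c · x^a' y^b' z^c' = x^(a+a') y^(b+b') z^(c+c'+b a').
  mulH : H p → H p → H p
  mulH (a , b , c) (a' , b' , c') =
    ((toℕ a ℕ.+ toℕ a') mod p ,
     (toℕ b ℕ.+ toℕ b') mod p ,
     (toℕ c ℕ.+ toℕ c' ℕ.+ toℕ b ℕ.* toℕ a') mod p)

  negMod : Fin p → Fin p
  negMod a = (p ℕ.∸ toℕ a) mod p

  invH : H p → H p
  invH (a , b , c) =
    (negMod a , negMod b , (toℕ a ℕ.* toℕ b ℕ.+ (p ℕ.∸ toℕ c)) mod p)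

  elemH : Fin (p ℕ.* (p ℕ.* p)) → H p
  elemH i with remQuot {p} (p ℕ.* p) i
  ... | (a , j) with remQuot {p} p j
  ...   | (b , c) = (a , b , c)

  groupMatrix : (Fin p → Fin p → Fin p → ℤ) →
                Fin (p ℕ.* (p ℕ.* p)) → Fin (p ℕ.* (p ℕ.* p)) → ℤ
  groupMatrix coeff r s with mulH (elemH r) (invH (elemH s))
  ... | (i , j , k) = coeff i j k

  groupDet : (Fin p → Fin p → Fin p → ℤ) → ℤ
  groupDet coeff = det (p ℕ.* (p ℕ.* p)) (groupMatrix coeff)

  evalOne : (Fin p → Fin p → Fin p → ℤ) → ℤ
  evalOne coeff = sumFin p (λ i → sumFin p (λ j → sumFin p (λ k → coeff i j k)))

{-# OPTIONS --safe #-}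
-- Let p be an odd prime and G a group of order n = pᵉ⁺¹ and exponent p, and work in
-- R = ℤ[[X]] / (n , Xⁿ⁺¹).  Left multiplication by 1 + s g changes the matrix
-- (a (r u⁻¹)) of an element a of R[G] by row operations along the cycles of g, all of
-- length p, so for g ≠ 1 it multiplies the determinant by (1 + sᵖ)^(n/p), which equals
-- (1 + s)ⁿ because n = 0 in R.  It multiplies the sum of the coefficients by 1 + s.
-- Every element congruent to 1 modulo X is reduced to 1 by such factors with s divisible
-- by X, and then 1 + s is a unit; hence the determinant of such an element is the n-th
-- power of the sum of its coefficients.  For 1 + X F the coefficients of Xⁿ on the two
-- sides are the group determinant of F and the n-th power of the coefficient sum of F.
-- The Heisenberg group has exponent p because p divides p (p - 1) / 2.

module Submission where

open import Algebra.Bundles using (CommutativeRing; Group)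
import Algebra.Properties.CommutativeSemiring.Binomial
import Algebra.Properties.CommutativeSemiring.Exp
import Algebra.Properties.Group
import Algebra.Properties.Loop
import Algebra.Properties.Monoid.Mult
import Algebra.Properties.Quasigroup
import Algebra.Properties.Ring
import Algebra.Properties.Semiring.Exp
import Algebra.Properties.Semiring.Mult
import Algebra.Properties.Semiring.Sum
import Algebra.Solver.Ring.NaturalCoefficients.Default
open import Algebra.Structures using (IsGroup)
open import Data.Bool.Base as Bool using (if_then_else_)
open import Data.Fin.Base using (Fin; zero; suc; toℕ; fromℕ; fromℕ<; inject₁; punchIn; combine; remQuot; _↑ˡ_; _↑ʳ_)
open import Data.Fin.Permutation using (Permutation; permutation)
import Data.Fin.Properties as Finₚ
open import Data.Integer as ℤ using (ℤ; +_)
open import Data.Integer.Divisibility using (_∣_)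
import Data.Integer.Divisibility.Signed as Signed
import Data.Integer.Properties as ℤₚ
import Data.Integer.Tactic.RingSolver as ℤ-Solver
open import Data.Nat as ℕ using (ℕ; zero; suc; z≤n; s≤s)
open import Data.Nat.Combinatorics using (nC1≡n; nCn≡1; nCk+nC[k+1]≡[n+1]C[k+1]) renaming (_C_ to _choose_)
open import Data.Nat.Coprimality using (coprime-Bézout; prime⇒coprime)
open import Data.Nat.DivMod using (_%_; _/_; _mod_; %-distribˡ-+; %-distribˡ-*; m%n<n; m%n%n≡m%n; m<n⇒m%n≡m; m*n%n≡0; m≡m%n+[m/n]*n)
open import Data.Nat.Divisibility using (divides; quotient; ∣⇒≤; m∣n⇒n≡quotient*m) renaming (_∣_ to _∣ₙ_)
open import Data.Nat.GCD using (module Bézout)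
open import Data.Nat.Primality using (Prime; euclidsLemma; prime⇒irreducible; prime⇒nonZero)
import Data.Nat.Properties as ℕₚ
import Data.Nat.Tactic.RingSolver as ℕ-Solver
open import Data.Product.Base using (_×_; _,_; proj₁; proj₂; ∃)
open import Data.Sum.Base using (_⊎_; inj₁; inj₂)
open import Data.Unit.Polymorphic.Base using (⊤; tt)
open import Data.Vec.Functional using (updateAt)
open import Data.Vec.Functional.Properties using (updateAt-updates; updateAt-minimal)
open import Function.Base using (_∘_; id)
open import Level using (_⊔_)
open import Relation.Binary.PropositionalEquality as ≡ using (_≡_; _≢_)
import Relation.Binary.Reasoning.Setoid
open import Relation.Nullary using (Dec; does; yes; no; ¬_; ¬?; contradiction; decidable-stable)
open import Relation.Nullary.Decidable using (dec-true; dec-false)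

-- An arbitrary `F` is neither a unit nor close to 1, so factors 1 + s g cannot reduce it directly.
-- Passing to 1 + X F costs nothing, since the determinant then has degree at most n in X and its
-- coefficient of degree n sees only `F`; truncating after degree n makes X nilpotent and just keeps
-- that coefficient. The modulus comes from counting cycles: (1 + s)^p and 1 + s^p agree modulo p,
-- and raising both to the number of cycles, n/p = p^e, improves this to p^(e+1) = n. Cycles of
-- length p^2 would be fewer and, by the same argument, give only p^e; hence the restriction to
-- exponent p. Oddness of p enters twice: in the sign of a cycle of length p, where 1 - (-s)^p
-- becomes 1 + s^p, and in the exponent of the Heisenberg group. Since only factors 1 + s g occur,
-- row operations take the place of a general product formula for determinants.

-- Determinants over a commutative ring: Laplace expansion, alternation, row operations

module Determinant {c ℓ} (R : CommutativeRing c ℓ) where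

  open CommutativeRing R hiding (zero)
  open Algebra.Properties.Ring ring
  open Algebra.Properties.Semiring.Exp semiring
  open Algebra.Properties.Semiring.Sum semiring
  open Relation.Binary.Reasoning.Setoid setoid
  open Algebra.Solver.Ring.NaturalCoefficients.Default commutativeSemiring using (solve; _:=_; _:+_; _:*_)

  Matrix : ℕ → Set c
  Matrix n = Fin n → Fin n → Carrier

  minor : ∀ {n} → Matrix (suc n) → Fin (suc n) → Matrix n
  minor A j r k = A (suc r) (punchIn j k)

  sgn : ℕ → Carrier
  sgn zero    = 1#
  sgn (suc n) = - 1# * sgn n

  -- Has the same shape as the integer `det`, term by term, so that `Top-Det` can compare the two by
  -- induction on the size.
  Det : ∀ n → Matrix n → Carrier
  laplace : ∀ n → Matrix (suc n) → Fin (suc n) → Carrier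

  Det zero    A = 1#
  Det (suc n) A = sum (laplace n A)
  laplace n A j = sgn (toℕ j) * A zero j * Det n (minor A j)

  -- Recursion on both indices makes the minor at the first diagonal entry the smaller identity by
  -- computation.
  identity : ∀ n → Matrix n
  identity (suc n) zero    zero    = 1#
  identity (suc n) zero    (suc j) = 0#
  identity (suc n) (suc i) zero    = 0#
  identity (suc n) (suc i) (suc j) = identity n i j

  identity-diagonal : ∀ n i → identity n i i ≡ 1#
  identity-diagonal (suc n) zero    = ≡.refl
  identity-diagonal (suc n) (suc i) = identity-diagonal n i

  identity-off-diagonal : ∀ n {i j} → i ≢ j → identity n i j ≡ 0#
  identity-off-diagonal (suc n) {zero}  {zero}  i≢j = contradiction ≡.refl i≢j
  identity-off-diagonal (suc n) {zero}  {suc j} i≢j = ≡.refl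
  identity-off-diagonal (suc n) {suc i} {zero}  i≢j = ≡.refl
  identity-off-diagonal (suc n) {suc i} {suc j} i≢j = identity-off-diagonal n (i≢j ∘ ≡.cong suc)

  private
    sum-cong : ∀ {n} (f g : Fin n → Carrier) → (∀ i → f i ≈ g i) → sum f ≈ sum g
    sum-cong f g = sum-cong-≋

    sum-zero : ∀ n {f : Fin n → Carrier} → (∀ i → f i ≈ 0#) → sum f ≈ 0#
    sum-zero n f≈0 = trans (sum-cong-≋ f≈0) (sum-replicate-zero n)

  Det-cong : ∀ n {A B : Matrix n} → (∀ i j → A i j ≈ B i j) → Det n A ≈ Det n B
  Det-cong zero    A≈B = refl
  Det-cong (suc n) {A} {B} A≈B = sum-cong (laplace n A) (laplace n B) λ j →
    *-cong (*-congˡ {sgn (toℕ j)} (A≈B zero j)) (Det-cong n {minor A j} {minor B j} λ r k → A≈B (suc r) (punchIn j k))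

  Det-identity : ∀ n → Det n (identity n) ≈ 1#
  Det-identity zero    = refl
  Det-identity (suc n) = begin
    1# * 1# * Det n (identity n) + sum {n} _ ≈⟨ +-cong (trans (*-congʳ (*-identityˡ 1#)) (*-identityˡ _))
                                                 (sum-zero n λ j → trans (*-congʳ (zeroʳ _)) (zeroˡ _)) ⟩
    Det n (identity n) + 0#              ≈⟨ +-identityʳ _ ⟩
    Det n (identity n)                   ≈⟨ Det-identity n ⟩
    1#                                   ∎

  private
    lin-first : ∀ σ a b s d → σ * (a + s * b) * d ≈ σ * a * d + s * (σ * b * d)
    lin-first = solve 5 (λ σ a b s d → σ :* (a :+ s :* b) :* d := σ :* a :* d :+ s :* (σ :* b :* d)) refl

    lin-rest : ∀ σ a s d e → σ * a * (d + s * e) ≈ σ * a * d + s * (σ * a * e)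
    lin-rest = solve 5 (λ σ a s d e → σ :* a :* (d :+ s :* e) := σ :* a :* d :+ s :* (σ :* a :* e)) refl

    sum-linear : ∀ {n} s (f g : Fin n → Carrier) →
                 sum (λ j → f j + s * g j) ≈ sum f + s * sum g
    sum-linear s f g = trans (∑-distrib-+ f (λ j → s * g j)) (+-congˡ (sym (*-distribˡ-sum s g)))

  -- One form covers both uses: with a repeated row in `B` it gives row operations, with `B` equal
  -- to `A` it gives scaling of a row.
  Det-linear : ∀ n (i : Fin n) (A B C : Matrix n) s →
               (∀ j → C i j ≈ A i j + s * B i j) →
               (∀ r → r ≢ i → ∀ j → C r j ≈ A r j) →
               (∀ r → r ≢ i → ∀ j → C r j ≈ B r j) →
               Det n C ≈ Det n A + s * Det n B
  Det-linear (suc n) zero A B C s Cᵢ C≈A C≈B = begin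
    Det (suc n) C
      ≈⟨ sum-cong (laplace n C) (λ j → laplace n A j + s * laplace n B j) (λ j → begin
           laplace n C j
             ≈⟨ *-congʳ (*-congˡ (Cᵢ j)) ⟩
           sgn (toℕ j) * (A zero j + s * B zero j) * Det n (minor C j)
             ≈⟨ lin-first (sgn (toℕ j)) (A zero j) (B zero j) s (Det n (minor C j)) ⟩
           sgn (toℕ j) * A zero j * Det n (minor C j) + s * (sgn (toℕ j) * B zero j * Det n (minor C j))
             ≈⟨ +-cong (*-congˡ (Det-cong n λ r k → C≈A (suc r) (λ ()) _))
                       (*-congˡ (*-congˡ (Det-cong n λ r k → C≈B (suc r) (λ ()) _))) ⟩
           laplace n A j + s * laplace n B j ∎) ⟩
    sum (λ j → laplace n A j + s * laplace n B j)
      ≈⟨ sum-linear s (laplace n A) (laplace n B) ⟩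
    Det (suc n) A + s * Det (suc n) B ∎
  Det-linear (suc n) (suc i) A B C s Cᵢ C≈A C≈B = begin
    Det (suc n) C
      ≈⟨ sum-cong (laplace n C) (λ j → laplace n A j + s * laplace n B j) (λ j → begin
           laplace n C j
             ≈⟨ *-congˡ {sgn (toℕ j) * C zero j} (Det-linear n i (minor A j) (minor B j) (minor C j) s
                  (λ k → Cᵢ _) (λ r r≢i k → C≈A (suc r) (r≢i ∘ Finₚ.suc-injective) _)
                  (λ r r≢i k → C≈B (suc r) (r≢i ∘ Finₚ.suc-injective) _)) ⟩
           sgn (toℕ j) * C zero j * (Det n (minor A j) + s * Det n (minor B j))
             ≈⟨ lin-rest (sgn (toℕ j)) (C zero j) s _ _ ⟩
           sgn (toℕ j) * C zero j * Det n (minor A j) + s * (sgn (toℕ j) * C zero j * Det n (minor B j))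
             ≈⟨ +-cong (*-congʳ (*-congˡ (C≈A zero (λ ()) j)))
                       (*-congˡ (*-congʳ (*-congˡ (C≈B zero (λ ()) j)))) ⟩
           laplace n A j + s * laplace n B j ∎) ⟩
    sum (λ j → laplace n A j + s * laplace n B j)
      ≈⟨ sum-linear s (laplace n A) (laplace n B) ⟩
    Det (suc n) A + s * Det (suc n) B ∎

  private
    -- The involution exchanges (j , k) with the pair that deletes the same two
    -- columns in the other order; here it is peeled off one row and column at a time.
    Antisymmetric : ∀ n → (Fin (suc n) → Fin n → Carrier) → Set ℓ
    Antisymmetric zero    f = ⊤
    Antisymmetric (suc n) f = (∀ k → f zero k + f (suc k) zero ≈ 0#) ×
                              Antisymmetric n (λ j k → f (suc j) (suc k))

    sum-antisymmetric : ∀ n f → Antisymmetric n f → sum (λ j → sum (f j)) ≈ 0#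
    sum-antisymmetric zero    f _ = +-identityʳ 0#
    sum-antisymmetric (suc n) f (border , rest) = begin
      sum (f zero) + sum (λ j → f (suc j) zero + sum (λ k → f (suc j) (suc k)))
        ≈⟨ +-congˡ (∑-distrib-+ (λ j → f (suc j) zero) (λ j → sum (λ k → f (suc j) (suc k)))) ⟩
      sum (f zero) + (sum (λ j → f (suc j) zero) + sum (λ j → sum (λ k → f (suc j) (suc k))))
        ≈⟨ sym (+-assoc _ _ _) ⟩
      sum (f zero) + sum (λ j → f (suc j) zero) + sum (λ j → sum (λ k → f (suc j) (suc k)))
        ≈⟨ +-cong (sym (∑-distrib-+ (f zero) (λ j → f (suc j) zero))) (sum-antisymmetric n _ rest) ⟩
      sum (λ k → f zero k + f (suc k) zero) + 0#
        ≈⟨ +-congʳ (sum-zero (suc n) border) ⟩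
      0# + 0#
        ≈⟨ +-identityʳ 0# ⟩
      0# ∎

    extend : ∀ {m n} → (Fin m → Fin n) → Fin (suc m) → Fin (suc n)
    extend h zero    = zero
    extend h (suc i) = suc (h i)

    -- Deleting column 0 before column k + 1 gives the indices (0 , k), the other order gives (k + 1
    -- , 0): the signs differ by one factor -1.
    cancel : ∀ σ a b g → 1# * a * (σ * b * g) + - 1# * σ * b * (1# * a * g) ≈ 0#
    cancel σ a b g = begin
      1# * a * (σ * b * g) + - 1# * σ * b * (1# * a * g)
        ≈⟨ +-cong (regroup₁ σ a b g 1#) (regroup₂ σ a b g 1# (- 1#)) ⟩
      x + - 1# * x   ≈⟨ +-congˡ (-1*x≈-x x) ⟩
      x + - x        ≈⟨ -‿inverseʳ x ⟩
      0#             ∎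
      where
      x = σ * (1# * a) * b * g
      regroup₁ : ∀ σ a b g o → o * a * (σ * b * g) ≈ σ * (o * a) * b * g
      regroup₁ = solve 5 (λ σ a b g o → o :* a :* (σ :* b :* g) := σ :* (o :* a) :* b :* g) refl
      regroup₂ : ∀ σ a b g o ε → ε * σ * b * (o * a * g) ≈ ε * (σ * (o * a) * b * g)
      regroup₂ = solve 6 (λ σ a b g o ε → ε :* σ :* b :* (o :* a :* g) := ε :* (σ :* (o :* a) :* b :* g)) refl

    -- When both deleted columns lie beyond column 0, shifting the two indices by one changes two
    -- signs.
    unsign : ∀ σ τ a b g → - 1# * σ * a * (- 1# * τ * b * g) ≈ σ * a * (τ * b * g)
    unsign σ τ a b g = begin
      - 1# * σ * a * (- 1# * τ * b * g)    ≈⟨ regroup (- 1#) σ τ a b g ⟩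
      - 1# * (- 1# * x)                    ≈⟨ trans (-1*x≈-x _) (-‿cong (-1*x≈-x x)) ⟩
      - - x                                ≈⟨ -‿involutive x ⟩
      x                                    ∎
      where
      x = σ * a * (τ * b * g)
      regroup : ∀ ε σ τ a b g → ε * σ * a * (ε * τ * b * g) ≈ ε * (ε * (σ * a * (τ * b * g)))
      regroup = solve 6 (λ ε σ τ a b g → ε :* σ :* a :* (ε :* τ :* b :* g) :=
                                         ε :* (ε :* (σ :* a :* (τ :* b :* g)))) refl

    -- G is a function of the unordered pair of deleted columns, presented by the
    -- embedding of the columns that remain.
    expansion : ∀ {n} → (Fin (suc (suc n)) → Carrier) → ((Fin n → Fin (suc (suc n))) → Carrier) →
                Fin (suc (suc n)) → Fin (suc n) → Carrier
    expansion u G j k = sgn (toℕ j) * u j *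
      (sgn (toℕ k) * u (punchIn j k) * G (λ l → punchIn j (punchIn k l)))

    Antisymmetric-cong : ∀ n {f g} → (∀ j k → f j k ≈ g j k) → Antisymmetric n f → Antisymmetric n g
    Antisymmetric-cong zero    f≈g _ = tt
    Antisymmetric-cong (suc n) f≈g (border , rest) =
      (λ k → trans (+-cong (sym (f≈g _ _)) (sym (f≈g _ _))) (border k)) ,
      Antisymmetric-cong n (λ j k → f≈g _ _) rest

    expansion-antisymmetric : ∀ n u G → (∀ {h h′} → (∀ l → h l ≡ h′ l) → G h ≈ G h′) →
                              Antisymmetric (suc n) (expansion {n} u G)
    expansion-antisymmetric n u G G-cong =
      -- `punchIn zero (punchIn k l)` and `punchIn (suc k) (punchIn zero l)` both compute to
      -- `suc (punchIn k l)`, so the two terms share one value of `G`.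
      (λ k → cancel (sgn (toℕ k)) (u zero) (u (suc k)) _) , rest n u G G-cong
      where
      rest : ∀ n u G → (∀ {h h′} → (∀ l → h l ≡ h′ l) → G h ≈ G h′) →
             Antisymmetric n (λ j k → expansion {n} u G (suc j) (suc k))
      rest zero    u G G-cong = tt
      -- Column 0 survives both deletions; `extend` puts it back, and the induction runs on the
      -- other columns with `G ∘ extend`.
      rest (suc n) u G G-cong = Antisymmetric-cong (suc n)
        (λ j k → sym (trans
          (unsign (sgn (toℕ j)) (sgn (toℕ k)) (u (suc j)) (u (suc (punchIn j k))) _)
          (*-congˡ {sgn (toℕ j) * u (suc j)} (*-congˡ {sgn (toℕ k) * u (suc (punchIn j k))}
            (G-cong {λ l → punchIn (suc j) (punchIn (suc k) l)} {extend (λ l → punchIn j (punchIn k l))}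
              λ { zero → ≡.refl ; (suc l) → ≡.refl })))))
        (expansion-antisymmetric n (u ∘ suc) (G ∘ extend)
          (λ h≡h′ → G-cong λ { zero → ≡.refl ; (suc l) → ≡.cong suc (h≡h′ l) }))

  private
    addRow : ∀ {n} → Matrix n → Fin n → Carrier → Fin n → Matrix n
    addRow A i s j = updateAt A i (λ row k → row k + s * A j k)

    addRow-updates : ∀ {n} (A : Matrix n) i s j k → addRow A i s j i k ≈ A i k + s * A j k
    addRow-updates A i s j k = reflexive (≡.cong (λ row → row k) (updateAt-updates i A))

    addRow-minimal : ∀ {n} (A : Matrix n) i s j r → r ≢ i → ∀ k → addRow A i s j r k ≈ A r k
    addRow-minimal A i s j r r≢i k = reflexive (≡.cong (λ row → row k) (updateAt-minimal r i A r≢i))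

    -- A predicate of a single size, because alternation at size n + 1 is obtained from row
    -- operations at size n.
    Alternating : ℕ → Set (c ⊔ ℓ)
    Alternating n = ∀ (A : Matrix n) {i j} → i ≢ j → (∀ k → A i k ≈ A j k) → Det n A ≈ 0#

    -- Linearity in row `i` leaves an error of `s` times the determinant of `A` with row `i`
    -- overwritten by row `j`, and that matrix has two equal rows.
    Det-alternating⇒row-operation : ∀ n → Alternating n →
      ∀ (A C : Matrix n) {i j} s → i ≢ j →
      (∀ k → C i k ≈ A i k + s * A j k) → (∀ r → r ≢ i → ∀ k → C r k ≈ A r k) →
      Det n C ≈ Det n A
    Det-alternating⇒row-operation n alt A C {i} {j} s i≢j Cᵢ C≈A = begin
      Det n C                ≈⟨ Det-linear n i A B C s
                                  (λ k → trans (Cᵢ k) (+-congˡ (*-congˡ (sym (B-updates k)))))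
                                  C≈A
                                  (λ r r≢i k → trans (C≈A r r≢i k) (sym (B-minimal r r≢i k))) ⟩
      Det n A + s * Det n B  ≈⟨ +-congˡ (*-congˡ (alt B i≢j λ k →
                                  trans (B-updates k) (sym (B-minimal j (i≢j ∘ ≡.sym) k)))) ⟩
      Det n A + s * 0#       ≈⟨ trans (+-congˡ (zeroʳ s)) (+-identityʳ _) ⟩
      Det n A                ∎
      where
      B : Matrix n
      B = updateAt A i (λ _ → A j)
      B-updates : ∀ k → B i k ≈ A j k
      B-updates k = reflexive (≡.cong (λ row → row k) (updateAt-updates i A))
      B-minimal : ∀ r → r ≢ i → ∀ k → B r k ≈ A r k
      B-minimal r r≢i k = reflexive (≡.cong (λ row → row k) (updateAt-minimal r i A r≢i))

    -- If rows 0 and 1 agree, expanding along both gives a double sum that is antisymmetric in the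
    -- two deleted columns. Any other row is first brought to this case; operations below row 0 act
    -- on every minor at once, so alternation at size `n` suffices.
    Det-alternating-first : ∀ n → Alternating n → ∀ (A : Matrix (suc n)) j →
                            (∀ k → A zero k ≈ A (suc j) k) → Det (suc n) A ≈ 0#
    Det-alternating-first (suc n) _ A zero A₀≈A₁ = begin
      Det (suc (suc n)) A
        ≈⟨ sum-cong (laplace (suc n) A) (λ j → sum (expansion (A zero) G j)) (λ j →
             trans (*-distribˡ-sum _ (term j)) (sum-cong (λ k → _ * term j k) (expansion (A zero) G j) λ k →
             *-congˡ {sgn (toℕ j) * A zero j} (*-congʳ {D j k} (*-congˡ {sgn (toℕ k)} (sym (A₀≈A₁ (punchIn j k))))))) ⟩
      sum (λ j → sum (expansion (A zero) G j))
        ≈⟨ sum-antisymmetric (suc n) (expansion (A zero) G) (expansion-antisymmetric n (A zero) G G-cong) ⟩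
      0# ∎
      where
      G : (Fin n → Fin (suc (suc n))) → Carrier
      G h = Det n (λ r l → A (suc (suc r)) (h l))
      G-cong : ∀ {h h′} → (∀ l → h l ≡ h′ l) → G h ≈ G h′
      G-cong h≡h′ = Det-cong n λ r l → reflexive (≡.cong (A (suc (suc r))) (h≡h′ l))
      D : Fin (suc (suc n)) → Fin (suc n) → Carrier
      D j k = Det n (minor (minor A j) k)
      term : Fin (suc (suc n)) → Fin (suc n) → Carrier
      term j k = sgn (toℕ k) * minor A j zero k * D j k
    -- Rows (u , v , … , u) become (u , u , … , - v) by operations among the rows below the first.
    Det-alternating-first n@(suc n′) alt A i@(suc _) A₀≈Aᵢ = begin
      Det (suc n) A   ≈⟨ lower A 1# {zero} {i} (λ ()) ⟨
      Det (suc n) A₁  ≈⟨ lower A₁ (- 1#) {i} {zero} (λ ()) ⟨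
      Det (suc n) A₂  ≈⟨ lower A₂ 1# {zero} {i} (λ ()) ⟨
      Det (suc n) A₃  ≈⟨ Det-alternating-first n alt A₃ zero (λ k → sym (row₁ k)) ⟩
      0#              ∎
      where
      lower : ∀ B s {i j} → i ≢ j → Det (suc n) (addRow B (suc i) s (suc j)) ≈ Det (suc n) B
      lower B s {i} {j} i≢j = sum-cong (laplace n (addRow B (suc i) s (suc j))) (laplace n B) λ k →
        *-congˡ {sgn (toℕ k) * B zero k} (Det-alternating⇒row-operation n alt
        (minor B k) (minor (addRow B (suc i) s (suc j)) k) s i≢j
        (λ l → addRow-updates B (suc i) s (suc j) (punchIn k l))
        (λ r r≢i l → addRow-minimal B (suc i) s (suc j) (suc r) (r≢i ∘ Finₚ.suc-injective) (punchIn k l)))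
      A₁ A₂ A₃ : Matrix (suc n)
      A₁ = addRow A (suc zero) 1# (suc i)
      A₂ = addRow A₁ (suc i) (- 1#) (suc zero)
      A₃ = addRow A₂ (suc zero) 1# (suc i)
      row₁ : ∀ k → A₃ (suc zero) k ≈ A₃ zero k
      row₁ k = begin
        A₂ (suc zero) k + 1# * A₂ (suc i) k  ≈⟨ +-congˡ (*-congˡ (addRow-updates A₁ (suc i) (- 1#) (suc zero) k)) ⟩
        A₁ (suc zero) k + 1# * (A (suc i) k + - 1# * A₁ (suc zero) k)
                                             ≈⟨ +-congˡ (trans (*-identityˡ _) (+-comm _ _)) ⟩
        x + (- 1# * x + A (suc i) k)         ≈⟨ sym (+-assoc _ _ _) ⟩
        x + - 1# * x + A (suc i) k           ≈⟨ +-congʳ (trans (+-congˡ (-1*x≈-x x)) (-‿inverseʳ x)) ⟩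
        0# + A (suc i) k                     ≈⟨ trans (+-identityˡ _) (sym (A₀≈Aᵢ k)) ⟩
        A zero k                             ∎
        where x = A₁ (suc zero) k

  Det-alternating : ∀ n → Alternating n
  Det-alternating (suc n) A {zero}  {zero}  i≢j Aᵢ≈Aⱼ = contradiction ≡.refl i≢j
  Det-alternating (suc n) A {zero}  {suc j} i≢j Aᵢ≈Aⱼ = Det-alternating-first n (Det-alternating n) A j Aᵢ≈Aⱼ
  Det-alternating (suc n) A {suc i} {zero}  i≢j Aᵢ≈Aⱼ = Det-alternating-first n (Det-alternating n) A i (sym ∘ Aᵢ≈Aⱼ)
  Det-alternating (suc n) A {suc i} {suc j} i≢j Aᵢ≈Aⱼ = sum-zero (suc n) {laplace n A} λ k →
    trans (*-congˡ (Det-alternating n (minor A k) (i≢j ∘ ≡.cong suc) (λ l → Aᵢ≈Aⱼ (punchIn k l)))) (zeroʳ _)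

  Det-row-operation : ∀ n (A C : Matrix n) {i j} s → i ≢ j →
    (∀ k → C i k ≈ A i k + s * A j k) → (∀ r → r ≢ i → ∀ k → C r k ≈ A r k) →
    Det n C ≈ Det n A
  Det-row-operation n = Det-alternating⇒row-operation n (Det-alternating n)

  Det-scale-row : ∀ n (A C : Matrix n) i s →
    (∀ k → C i k ≈ s * A i k) → (∀ r → r ≢ i → ∀ k → C r k ≈ A r k) →
    Det n C ≈ s * Det n A
  Det-scale-row n A C i s Cᵢ C≈A = begin
    -- Scaling by `s` is adding `s - 1` times the row to itself.
    Det n C                          ≈⟨ Det-linear n i A A C (s - 1#) (λ k → trans (Cᵢ k) (sym (split (A i k)))) C≈A C≈A ⟩
    Det n A + (s - 1#) * Det n A     ≈⟨ split (Det n A) ⟩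
    s * Det n A                      ∎
    where
    split : ∀ x → x + (s - 1#) * x ≈ s * x
    split x = begin
      x + (s - 1#) * x           ≈⟨ +-congˡ (distribʳ x s (- 1#)) ⟩
      x + (s * x + - 1# * x)     ≈⟨ +-congˡ (+-comm _ _) ⟩
      x + (- 1# * x + s * x)     ≈⟨ sym (+-assoc _ _ _) ⟩
      x + - 1# * x + s * x       ≈⟨ +-congʳ (trans (+-congˡ (-1*x≈-x x)) (-‿inverseʳ x)) ⟩
      0# + s * x                 ≈⟨ +-identityˡ _ ⟩
      s * x                      ∎

  Det-scale : ∀ n s (A : Matrix n) → Det n (λ i j → s * A i j) ≈ s ^ n * Det n A
  Det-scale zero    s A = sym (*-identityˡ 1#)
  Det-scale (suc n) s A = trans
    (sum-cong (laplace n (λ i j → s * A i j)) (λ j → s ^ suc n * laplace n A j) λ j →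
      trans (*-congˡ {sgn (toℕ j) * (s * A zero j)} (Det-scale n s (minor A j)))
            (regroup (sgn (toℕ j)) s (A zero j) (s ^ n) (Det n (minor A j))))
    (sym (*-distribˡ-sum (s ^ suc n) (laplace n A)))
    where
    regroup : ∀ σ s a S d → σ * (s * a) * (S * d) ≈ s * S * (σ * a * d)
    regroup = solve 5 (λ σ s a S d → σ :* (s :* a) :* (S :* d) := s :* S :* (σ :* a :* d)) refl

-- Row operations along one cycle

module RowCycles {c ℓ} (R : CommutativeRing c ℓ) where

  open CommutativeRing R hiding (zero)
  open Relation.Binary.Reasoning.Setoid setoid
  open Algebra.Solver.Ring.NaturalCoefficients.Default commutativeSemiring using (solve; _:=_; _:+_; _:*_)
  open Determinant R

  -- The signed power - (- s)ᵐ⁺¹, which is sᵐ⁺¹ when m is even.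
  κ : Carrier → ℕ → Carrier
  κ s zero    = s
  κ s (suc m) = - κ s m * s

  -- Adding multiples of the other rows of the cycle to B′ (f 0) turns that row into
  -- (1 + κ s q) times B (f 0); the remaining rows of the cycle are then obtained from
  -- those of B one after the other.
  module _ {n} (B B′ : Matrix n) (s : Carrier) (q : ℕ) (f : ℕ → Fin n)
    (closed : f (suc q) ≡ f 0)
    (injective : ∀ {i j} → i ℕ.≤ q → j ℕ.≤ q → f i ≡ f j → i ≡ j)
    (on-cycle : ∀ {j} → j ℕ.≤ q → ∀ k → B′ (f j) k ≈ B (f j) k + s * B (f (suc j)) k)
    (off-cycle : ∀ r → (∀ {j} → j ℕ.≤ q → r ≢ f j) → ∀ k → B′ r k ≈ B r k)
    where

    private
      setRow : Matrix n → Fin n → (Fin n → Carrier) → Matrix n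
      setRow A i row = updateAt A i (λ _ → row)

      setRow-updates : ∀ A i row k → setRow A i row i k ≈ row k
      setRow-updates A i row k = reflexive (≡.cong (λ row′ → row′ k) (updateAt-updates i A))

      setRow-minimal : ∀ A i row r → r ≢ i → ∀ k → setRow A i row r k ≈ A r k
      setRow-minimal A i row r r≢i k = reflexive (≡.cong (λ row′ → row′ k) (updateAt-minimal r i A r≢i))

      -- Stages of clearing row `f 0` of `B′`: the row holds `B (f 0)` and a multiple of a single
      -- other row of `B`, which moves along the cycle until at stage `q` it is `B (f 0)` again.
      E : ℕ → Matrix n
      E m = setRow B′ (f 0) (λ k → B (f 0) k + κ s m * B (f (suc m)) k)

      E-rest : ∀ m r → r ≢ f 0 → ∀ k → E m r k ≈ B′ r k
      E-rest m = setRow-minimal B′ (f 0) _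

      telescope : ∀ a x y t → a + t * x + - t * (x + s * y) ≈ a + - t * s * y
      telescope a x y t = begin
        a + t * x + - t * (x + s * y)      ≈⟨ regroup a x y t (- t) s ⟩
        (t * x + - t * x) + (a + - t * s * y) ≈⟨ +-congʳ (trans (sym (distribʳ x t (- t))) (trans (*-congʳ (-‿inverseʳ t)) (zeroˡ x))) ⟩
        0# + (a + - t * s * y)             ≈⟨ +-identityˡ _ ⟩
        a + - t * s * y                    ∎
        where
        regroup : ∀ a x y t t′ s → a + t * x + t′ * (x + s * y) ≈ (t * x + t′ * x) + (a + t′ * s * y)
        regroup = solve 6 (λ a x y t t′ s → a :+ t :* x :+ t′ :* (x :+ s :* y) :=
                                            (t :* x :+ t′ :* x) :+ (a :+ t′ :* s :* y)) refl

      f-distinct : ∀ {i j} → i ℕ.≤ q → j ℕ.≤ q → i ≢ j → f i ≢ f j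
      f-distinct i≤q j≤q i≢j fᵢ≡fⱼ = i≢j (injective i≤q j≤q fᵢ≡fⱼ)

      -- Subtracting `κ s m` times row `f (suc m)`, still the row of `B′`, trades the term in
      -- `B (f (suc m))` for one in the next row with coefficient `- κ s m * s`.
      Det-E : ∀ m → m ℕ.≤ q → Det n (E m) ≈ Det n B′
      Det-E zero    _   = Det-cong n λ r k → row r k (r Finₚ.≟ f 0)
        where
        row : ∀ r k → _ → E 0 r k ≈ B′ r k
        row r k (yes ≡.refl) = trans (setRow-updates B′ (f 0) _ k) (sym (on-cycle z≤n k))
        row r k (no r≢f₀)    = E-rest 0 r r≢f₀ k
      Det-E (suc m) m<q = trans
        (Det-row-operation n (E m) (E (suc m)) {f 0} {f (suc m)} (- κ s m) (f₀≢ ∘ ≡.sym)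
          (λ k → begin
            E (suc m) (f 0) k                                ≈⟨ setRow-updates B′ (f 0) _ k ⟩
            B (f 0) k + - κ s m * s * B (f (suc (suc m))) k  ≈⟨ telescope _ _ _ _ ⟨
            B (f 0) k + κ s m * B (f (suc m)) k + - κ s m * (B (f (suc m)) k + s * B (f (suc (suc m))) k)
              ≈⟨ +-cong (setRow-updates B′ (f 0) _ k)
                        (*-congˡ (trans (E-rest m (f (suc m)) f₀≢ k) (on-cycle m<q k))) ⟨
            E m (f 0) k + - κ s m * E m (f (suc m)) k        ∎)
          (λ r r≢f₀ k → trans (E-rest (suc m) r r≢f₀ k) (sym (E-rest m r r≢f₀ k))))
        (Det-E m (ℕₚ.<⇒≤ m<q))
        where
        f₀≢ : f (suc m) ≢ f 0
        f₀≢ = f-distinct m<q z≤n λ ()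

      -- Stages from `B` towards `B′` in which row `f 0` is never touched. The order matters: row
      -- `f (suc m)` is replaced while its successor is still a row of `B`.
      F : ℕ → Matrix n
      F zero    = B
      F (suc m) = setRow (F m) (f (suc m)) (B′ (f (suc m)))

      F-fixed : ∀ m r → (∀ {j} → j ℕ.< m → r ≢ f (suc j)) → ∀ k → F m r k ≈ B r k
      F-fixed zero    r _   k = refl
      F-fixed (suc m) r r≢f k = trans (setRow-minimal (F m) _ _ r (r≢f ℕₚ.≤-refl) k)
                                      (F-fixed m r (λ j<m → r≢f (ℕₚ.m<n⇒m<1+n j<m)) k)

      -- For `m = q` the row is `f 0` because the cycle closes; otherwise it has not been reached
      -- yet.
      F-next : ∀ m → m ℕ.≤ q → ∀ k → F m (f (suc m)) k ≈ B (f (suc m)) k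
      F-next m m≤q = F-fixed m (f (suc m)) λ {j} j<m → distinct j j<m (m ℕ.≟ q)
        where
        distinct : ∀ j → j ℕ.< m → _ → f (suc m) ≢ f (suc j)
        distinct j j<m (yes ≡.refl) eq =
          f-distinct z≤n j<m (λ ()) (≡.trans (≡.sym closed) eq)
        distinct j j<m (no m≢q) =
          f-distinct (ℕₚ.≤∧≢⇒< m≤q m≢q) (ℕₚ.≤-trans j<m m≤q)
            (λ eq → ℕₚ.<⇒≢ j<m (≡.sym (ℕₚ.suc-injective eq)))

      F-done : ∀ m → (∀ j → j ℕ.≤ m → j ℕ.≤ q) → ∀ r → r ≢ f 0 →
               (∀ k → F m r k ≈ B′ r k) ⊎ (∀ {j} → j ℕ.≤ m → r ≢ f j)
      F-done zero    _   r r≢f₀ = inj₂ λ { z≤n → r≢f₀ }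
      F-done (suc m) m≤q r r≢f₀ with r Finₚ.≟ f (suc m)
      ... | yes ≡.refl = inj₁ (setRow-updates (F m) _ _)
      ... | no  r≢     with F-done m (λ j j≤m → m≤q j (ℕₚ.m≤n⇒m≤1+n j≤m)) r r≢f₀
      ...   | inj₁ eq = inj₁ λ k → trans (setRow-minimal (F m) _ _ r r≢ k) (eq k)
      ...   | inj₂ r≢f = inj₂ λ {j} j≤1+m → case j j≤1+m (j ℕ.≟ suc m)
        where
        case : ∀ j → j ℕ.≤ suc m → _ → r ≢ f j
        case j j≤1+m (yes ≡.refl) = r≢
        case j j≤1+m (no j≢)      = r≢f (ℕ.s≤s⁻¹ (ℕₚ.≤∧≢⇒< j≤1+m j≢))

      Det-F : ∀ m → m ℕ.≤ q → Det n (F m) ≈ Det n B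
      Det-F zero    _   = refl
      Det-F (suc m) m<q = trans
        (Det-row-operation n (F m) (F (suc m)) {f (suc m)} {f (suc (suc m))} s
          (distinct (suc m ℕ.≟ q))
          (λ k → begin
            F (suc m) (f (suc m)) k                    ≈⟨ setRow-updates (F m) _ _ k ⟩
            B′ (f (suc m)) k                           ≈⟨ on-cycle m<q k ⟩
            B (f (suc m)) k + s * B (f (suc (suc m))) k
              ≈⟨ +-cong (F-next m (ℕₚ.<⇒≤ m<q) k)
                        (*-congˡ (trans (sym (setRow-minimal (F m) _ _ _ (distinct (suc m ℕ.≟ q) ∘ ≡.sym) k))
                                        (F-next (suc m) m<q k))) ⟨
            F m (f (suc m)) k + s * F m (f (suc (suc m))) k ∎)
          (setRow-minimal (F m) _ _))
        (Det-F m (ℕₚ.<⇒≤ m<q))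
        where
        distinct : _ → f (suc m) ≢ f (suc (suc m))
        distinct (yes ≡.refl) eq = f-distinct z≤n m<q (λ ()) (≡.trans (≡.sym closed) (≡.sym eq))
        distinct (no m+1≢q)      = f-distinct m<q (ℕₚ.≤∧≢⇒< m<q m+1≢q) (ℕₚ.<⇒≢ ℕₚ.≤-refl)

    Det-cycle : Det n B′ ≈ (1# + κ s q) * Det n B
    Det-cycle = begin
      Det n B′                     ≈⟨ Det-E q ℕₚ.≤-refl ⟨
      -- `E q` and `F q` differ only in row `f 0`, where the former is a multiple of the latter.
      Det n (E q)                  ≈⟨ Det-scale-row n (F q) (E q) (f 0) (1# + κ s q)
                                        (λ k → begin
                                          E q (f 0) k                             ≈⟨ setRow-updates B′ (f 0) _ k ⟩
                                          B (f 0) k + κ s q * B (f (suc q)) k     ≈⟨ +-cong (sym (*-identityˡ _)) (*-congˡ (reflexive (≡.cong (λ r → B r k) closed))) ⟩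
                                          1# * B (f 0) k + κ s q * B (f 0) k      ≈⟨ distribʳ _ _ _ ⟨
                                          (1# + κ s q) * B (f 0) k                ≈⟨ *-congˡ (sym (F-fixed q (f 0) (λ j<q → f-distinct z≤n j<q λ ()) k)) ⟩
                                          (1# + κ s q) * F q (f 0) k              ∎)
                                        (λ r r≢f₀ k → trans (E-rest q r r≢f₀ k) (rest r r≢f₀ k (F-done q (λ _ → id) r r≢f₀))) ⟩
      (1# + κ s q) * Det n (F q)   ≈⟨ *-congˡ (Det-F q ℕₚ.≤-refl) ⟩
      (1# + κ s q) * Det n B       ∎
      where
      rest : ∀ r → r ≢ f 0 → ∀ k → _ → B′ r k ≈ F q r k
      rest r r≢f₀ k (inj₁ eq)  = sym (eq k)
      rest r r≢f₀ k (inj₂ r≢f) = trans (off-cycle r r≢f k) (sym (F-fixed q r (λ j<q → r≢f j<q) k))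

-- Row operations along a map whose orbits all have the same length

module FreeRotation {c ℓ} (R : CommutativeRing c ℓ) where

  open CommutativeRing R hiding (zero)
  open Algebra.Properties.Semiring.Exp semiring
  open Relation.Binary.Reasoning.Setoid setoid
  open Determinant R
  open RowCycles R

  module _ {n} (π : Fin n → Fin n) where

    iterate : ℕ → Fin n → Fin n
    iterate zero    x = x
    iterate (suc j) x = π (iterate j x)

    iterate-+ : ∀ i j x → iterate (i ℕ.+ j) x ≡ iterate i (iterate j x)
    iterate-+ zero    j x = ≡.refl
    iterate-+ (suc i) j x = ≡.cong π (iterate-+ i j x)

    module _ (q : ℕ)
      (periodic : ∀ x → iterate (suc q) x ≡ x)
      (free : ∀ {i j} → i ℕ.≤ q → j ℕ.≤ q → ∀ x → iterate i x ≡ iterate j x → i ≡ j)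
      (A : Matrix n) (s : Carrier)
      where

      private
        Covered : ∀ {k} → (Fin k → Fin n) → Fin n → Set
        Covered rs x = ∃ λ i → ∃ λ (j : Fin (suc q)) → iterate (toℕ j) (rs i) ≡ x

        covered? : ∀ {k} (rs : Fin k → Fin n) x → Dec (Covered rs x)
        covered? rs x = Finₚ.any? λ i → Finₚ.any? λ j → iterate (toℕ j) (rs i) Finₚ.≟ x

        cover : ∀ {k} (rs : Fin k → Fin n) i {j} → j ℕ.≤ q → Covered rs (iterate j (rs i))
        cover rs i j≤q = i , fromℕ< (s≤s j≤q) , ≡.cong (λ j → iterate j (rs i)) (Finₚ.toℕ-fromℕ< (s≤s j≤q))

        Covered-π : ∀ {k} (rs : Fin k → Fin n) {x} → Covered rs x → Covered rs (π x)
        Covered-π rs (i , j , ≡.refl) with toℕ j ℕ.≟ q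
        ... | yes j≡q = i , zero , ≡.sym (≡.trans (≡.cong (λ j → iterate (suc j) (rs i)) j≡q) (periodic (rs i)))
        ... | no  j≢q = cover rs i (ℕₚ.≤∧≢⇒< (ℕ.s≤s⁻¹ (Finₚ.toℕ<n j)) j≢q)

        Covered-iterate : ∀ {k} (rs : Fin k → Fin n) m {x} → Covered rs x → Covered rs (iterate m x)
        Covered-iterate rs zero    cov = cov
        Covered-iterate rs (suc m) cov = Covered-π rs (Covered-iterate rs m cov)

        -- Moving on by the remaining `suc q ∸ m` steps completes the period and returns to `x`.
        Covered-iterate⁻¹ : ∀ {k} (rs : Fin k → Fin n) {m} x → m ℕ.≤ q → Covered rs (iterate m x) → Covered rs x
        Covered-iterate⁻¹ rs {m} x m≤q cov = ≡.subst (Covered rs) back (Covered-iterate rs (suc q ℕ.∸ m) cov)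
          where
          back : iterate (suc q ℕ.∸ m) (iterate m x) ≡ x
          back = ≡.trans (≡.sym (iterate-+ (suc q ℕ.∸ m) m x))
                 (≡.trans (≡.cong (λ j → iterate j x) (ℕₚ.m∸n+n≡m (ℕₚ.m≤n⇒m≤1+n m≤q))) (periodic x))

        Independent : ∀ {k} → (Fin k → Fin n) → Set
        Independent rs = ∀ {i i′} {j j′ : Fin (suc q)} →
          iterate (toℕ j) (rs i) ≡ iterate (toℕ j′) (rs i′) → i ≡ i′ × j ≡ j′

        shifted : Matrix n
        shifted x k = A x k + s * A (π x) k

        -- Interpolates between `A`, for no representatives, and `shifted`, once every orbit has
        -- one.
        processed : ∀ {k} → (Fin k → Fin n) → Matrix n
        processed rs x k = if does (covered? rs x) then shifted x k else A x k

        processed-covered : ∀ {k} (rs : Fin k → Fin n) {x} → Covered rs x → ∀ l → processed rs x l ≡ shifted x l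
        processed-covered rs {x} cov l rewrite dec-true (covered? rs x) cov = ≡.refl

        processed-uncovered : ∀ {k} (rs : Fin k → Fin n) {x} → ¬ Covered rs x → ∀ l → processed rs x l ≡ A x l
        processed-uncovered rs {x} ¬cov l rewrite dec-false (covered? rs x) ¬cov = ≡.refl

        cons : ∀ {k} → Fin n → (Fin k → Fin n) → Fin (suc k) → Fin n
        cons r rs zero    = r
        cons r rs (suc i) = rs i

        cons-independent : ∀ {k} r (rs : Fin k → Fin n) → ¬ Covered rs r → Independent rs → Independent (cons r rs)
        cons-independent r rs ¬cov indep {zero}  {zero}  {j} {j′} eq =
          ≡.refl , Finₚ.toℕ-injective (free (ℕ.s≤s⁻¹ (Finₚ.toℕ<n j)) (ℕ.s≤s⁻¹ (Finₚ.toℕ<n j′)) r eq)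
        cons-independent r rs ¬cov indep {zero}  {suc i′} {j} {j′} eq =
          contradiction (Covered-iterate⁻¹ rs r (ℕ.s≤s⁻¹ (Finₚ.toℕ<n j)) (i′ , j′ , ≡.sym eq)) ¬cov
        cons-independent r rs ¬cov indep {suc i} {zero}  {j} {j′} eq =
          contradiction (Covered-iterate⁻¹ rs r (ℕ.s≤s⁻¹ (Finₚ.toℕ<n j′)) (i , j , eq)) ¬cov
        cons-independent r rs ¬cov indep {suc i} {suc i′} eq =
          let i≡i′ , j≡j′ = indep eq in ≡.cong suc i≡i′ , j≡j′

        independent⇒≤ : ∀ {k} (rs : Fin k → Fin n) → Independent rs → k ℕ.* suc q ℕ.≤ n
        independent⇒≤ {k} rs indep = Finₚ.injective⇒≤ {f = f} λ {x} {y} eq →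
          let i≡ , j≡ = indep eq in
          ≡.trans (≡.sym (Finₚ.combine-remQuot {k} (suc q) x))
            (≡.trans (≡.cong₂ combine i≡ j≡) (Finₚ.combine-remQuot {k} (suc q) y))
          where
          f : Fin (k ℕ.* suc q) → Fin n
          f x = iterate (toℕ (proj₂ (remQuot {k} (suc q) x))) (rs (proj₁ (remQuot {k} (suc q) x)))

        covered⇒≥ : ∀ {k} (rs : Fin k → Fin n) → (∀ x → Covered rs x) → n ℕ.≤ k ℕ.* suc q
        covered⇒≥ {k} rs cov = Finₚ.injective⇒≤ {f = g} λ {x} {y} eq →
          let i≡ , j≡ = Finₚ.combine-injective {k} (proj₁ (cov x)) _ _ _ eq in
          ≡.trans (≡.sym (proj₂ (proj₂ (cov x))))
            (≡.trans (≡.cong₂ (λ i j → iterate (toℕ j) (rs i)) i≡ j≡) (proj₂ (proj₂ (cov y))))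
          where
          g : Fin n → Fin (k ℕ.* suc q)
          g x = combine (proj₁ (cov x)) (proj₁ (proj₂ (cov x)))

        -- The orbit of `r` is disjoint from the covered ones, so its rows in `processed rs` are
        -- still those of `A` and form a single cycle for `Det-cycle`.
        Det-cons : ∀ {k} r (rs : Fin k → Fin n) → ¬ Covered rs r →
                   Det n (processed (cons r rs)) ≈ (1# + κ s q) * Det n (processed rs)
        Det-cons r rs ¬cov = Det-cycle (processed rs) (processed (cons r rs)) s q (λ j → iterate j r) (periodic r)
          (λ i≤q j≤q → free i≤q j≤q r)
          (λ {j} j≤q k → begin
            processed (cons r rs) (iterate j r) k            ≡⟨ processed-covered (cons r rs) (cover (cons r rs) zero j≤q) k ⟩
            A (iterate j r) k + s * A (iterate (suc j) r) k
              ≡⟨ ≡.cong₂ (λ a b → a + s * b) (processed-uncovered rs (¬cov ∘ Covered-iterate⁻¹ rs r j≤q) k)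
                   (processed-uncovered rs (next j≤q) k) ⟨
            processed rs (iterate j r) k + s * processed rs (iterate (suc j) r) k ∎)
          (λ x x≢ k → off x x≢ k (covered? rs x))
          where
          next : ∀ {j} → j ℕ.≤ q → ¬ Covered rs (iterate (suc j) r)
          next {j} j≤q with j ℕ.≟ q
          ... | yes ≡.refl = ¬cov ∘ ≡.subst (Covered rs) (periodic r)
          ... | no  j≢q    = ¬cov ∘ Covered-iterate⁻¹ rs r (ℕₚ.≤∧≢⇒< j≤q j≢q)
          off : ∀ x → (∀ {j} → j ℕ.≤ q → x ≢ iterate j r) → ∀ k → Dec (Covered rs x) →
                processed (cons r rs) x k ≈ processed rs x k
          off x x≢ k (yes (i , j , eq)) = reflexive (≡.trans
            (processed-covered (cons r rs) (suc i , j , eq) k) (≡.sym (processed-covered rs (i , j , eq) k)))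
          off x x≢ k (no ¬cov) = reflexive (≡.trans
            (processed-uncovered (cons r rs) (λ { (zero , j , eq) → x≢ (ℕ.s≤s⁻¹ (Finₚ.toℕ<n j)) (≡.sym eq)
                                                ; (suc i , j , eq) → ¬cov (i , j , eq) }) k)
            (≡.sym (processed-uncovered rs ¬cov k)))

        -- Each uncovered row starts a new orbit. Independence bounds `k ℕ.* suc q` by `n`, so the
        -- fuel `d` cannot run out; when nothing is uncovered the opposite bound holds too, and `k`
        -- is the number of orbits.
        exhaust : ∀ d {k} (rs : Fin k → Fin n) → Independent rs → n ℕ.< k ℕ.+ d →
                  Det n (processed rs) ≈ (1# + κ s q) ^ k * Det n A →
                  ∃ λ k → k ℕ.* suc q ≡ n × Det n shifted ≈ (1# + κ s q) ^ k * Det n A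
        exhaust zero {k} rs indep n<k _ = contradiction
          (ℕₚ.<-≤-trans (≡.subst (n ℕ.<_) (ℕₚ.+-identityʳ k) n<k)
            (ℕₚ.≤-trans (ℕₚ.m≤m*n k (suc q)) (independent⇒≤ rs indep)))
          (ℕₚ.<-irrefl ≡.refl)
        exhaust (suc d) {k} rs indep n<k+d Det≈ with Finₚ.any? (λ x → ¬? (covered? rs x))
        ... | yes (r , ¬cov) = exhaust d (cons r rs) (cons-independent r rs ¬cov indep)
          (≡.subst (n ℕ.<_) (ℕₚ.+-suc k d) n<k+d)
          (trans (Det-cons r rs ¬cov) (trans (*-congˡ Det≈) (sym (*-assoc _ _ _))))
        ... | no ¬∃ = k , ℕₚ.≤-antisym (independent⇒≤ rs indep) (covered⇒≥ rs cov) ,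
          trans (Det-cong n λ x l → reflexive (≡.sym (processed-covered rs (cov x) l))) Det≈
          where
          cov : ∀ x → Covered rs x
          cov x = decidable-stable (covered? rs x) λ ¬cov → ¬∃ (x , ¬cov)

      Det-rotation : ∃ λ k → k ℕ.* suc q ≡ n ×
        Det n (λ x l → A x l + s * A (π x) l) ≈ (1# + κ s q) ^ k * Det n A
      Det-rotation = exhaust (suc n) {0} (λ ()) (λ { {()} }) ℕₚ.≤-refl
        (trans (Det-cong n λ x l → reflexive (processed-uncovered {0} (λ ()) (λ ()) l)) (sym (*-identityˡ _)))

-- Binomial coefficients and the Frobenius congruence modulo prime powers

absorption : ∀ n k → suc k ℕ.* (suc n choose suc k) ≡ suc n ℕ.* (n choose k)
absorption zero    zero    = ≡.refl
absorption zero    (suc k) = ℕₚ.*-zeroʳ k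
absorption (suc n) zero    = ≡.trans (ℕₚ.*-identityˡ _) (≡.trans (nC1≡n (suc (suc n))) (≡.sym (ℕₚ.*-identityʳ _)))
absorption (suc n) (suc k) = begin
  suc (suc k) ℕ.* (suc (suc n) choose suc (suc k))          ≡⟨ ≡.cong (suc (suc k) ℕ.*_) (nCk+nC[k+1]≡[n+1]C[k+1] (suc n) (suc k)) ⟨
  suc (suc k) ℕ.* (a ℕ.+ (suc n choose suc (suc k)))        ≡⟨ ℕₚ.*-distribˡ-+ (suc (suc k)) a _ ⟩
  (a ℕ.+ suc k ℕ.* a) ℕ.+ suc (suc k) ℕ.* (suc n choose suc (suc k))
                                                       ≡⟨ ≡.cong₂ (λ u v → (a ℕ.+ u) ℕ.+ v) (absorption n k) (absorption n (suc k)) ⟩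
  (a ℕ.+ suc n ℕ.* (n choose k)) ℕ.+ suc n ℕ.* (n choose suc k)  ≡⟨ ℕₚ.+-assoc a _ _ ⟩
  a ℕ.+ (suc n ℕ.* (n choose k) ℕ.+ suc n ℕ.* (n choose suc k))  ≡⟨ ≡.cong (a ℕ.+_) (ℕₚ.*-distribˡ-+ (suc n) (n choose k) _) ⟨
  a ℕ.+ suc n ℕ.* ((n choose k) ℕ.+ (n choose suc k))            ≡⟨ ≡.cong (λ u → a ℕ.+ suc n ℕ.* u) (nCk+nC[k+1]≡[n+1]C[k+1] n k) ⟩
  suc (suc n) ℕ.* a                                    ∎
  where
  open ≡.≡-Reasoning
  a = suc n choose suc k

-- By `absorption` the prime divides `suc k` times the coefficient, and `suc k` is too small to be a
-- multiple of it.
prime∣nCk : ∀ {q} → Prime (suc q) → ∀ {k} → k ℕ.< q → suc q ∣ₙ (suc q choose suc k)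
prime∣nCk {q} pr {k} k<q with euclidsLemma (suc k) (suc q choose suc k) pr
  (divides (q choose k) (≡.trans (absorption q k) (ℕₚ.*-comm (suc q) (q choose k))))
... | inj₁ p∣k+1 = contradiction (∣⇒≤ p∣k+1) (ℕₚ.<⇒≱ (s≤s k<q))
... | inj₂ p∣C   = p∣C

module FrobeniusLift {c ℓ} (R : CommutativeRing c ℓ) where

  open CommutativeRing R hiding (zero)
  open Algebra.Properties.Ring ring
  open Algebra.Properties.Semiring.Exp semiring
  open Algebra.Properties.Semiring.Mult semiring renaming (_×_ to _·_)
  open Algebra.Properties.Semiring.Sum semiring
  open Relation.Binary.Reasoning.Setoid setoid
  open Algebra.Solver.Ring.NaturalCoefficients.Default commutativeSemiring using (solve; _:=_; _:+_; _:*_)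
  open RowCycles R using (κ)
  open Algebra.Properties.CommutativeSemiring.Binomial commutativeSemiring using (theorem)

  -- This is where the sign of a cycle disappears: the length p = q + 1 is odd.
  κ-even : ∀ s h → κ s (h ℕ.* 2) ≈ s ^ suc (h ℕ.* 2)
  κ-even s zero    = sym (*-identityʳ s)
  κ-even s (suc h) = begin
    - (- κ s (h ℕ.* 2) * s) * s     ≈⟨ *-congʳ (trans (-‿cong (sym (-‿distribˡ-* _ s))) (-‿involutive _)) ⟩
    κ s (h ℕ.* 2) * s * s           ≈⟨ *-congʳ (*-congʳ (κ-even s h)) ⟩
    s ^ suc (h ℕ.* 2) * s * s       ≈⟨ trans (*-congʳ (*-comm _ s)) (*-comm _ s) ⟩
    s ^ suc (suc h ℕ.* 2)           ∎

  ·1-homo-^ : ∀ m n → (m ℕ.^ n) · 1# ≈ (m · 1#) ^ n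
  ·1-homo-^ m zero    = +-identityʳ 1#
  ·1-homo-^ m (suc n) = trans (×1-homo-* m (m ℕ.^ n)) (*-congˡ (·1-homo-^ m n))

  second-order : ∀ y d j → ∃ λ v → (y + d) ^ suc j ≈ y ^ suc j + (suc j · 1#) * d * y ^ j + d * d * v
  second-order y d zero    = 0# , (begin
    (y + d) * 1#                                    ≈⟨ *-identityʳ _ ⟩
    y + d                                           ≈⟨ +-cong (*-identityʳ y) (trans (*-identityʳ _) (trans (*-congʳ (+-identityʳ 1#)) (*-identityˡ d))) ⟨
    y * 1# + (1# + 0#) * d * 1#                     ≈⟨ trans (+-congˡ (zeroʳ _)) (+-identityʳ _) ⟨
    y * 1# + (1# + 0#) * d * 1# + d * d * 0#        ∎)
  second-order y d (suc j) = let v , eq = second-order y d j in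
    (suc j · 1#) * y ^ j + v * (y + d) , (begin
    (y + d) * (y + d) ^ suc j   ≈⟨ *-congˡ eq ⟩
    (y + d) * (y * y ^ j + (suc j · 1#) * d * y ^ j + d * d * v)
      ≈⟨ step y d (y ^ j) (suc j · 1#) 1# v (sym (*-identityˡ _)) ⟩
    y * (y * y ^ j) + (1# + suc j · 1#) * d * (y * y ^ j) + d * d * ((suc j · 1#) * y ^ j + v * (y + d)) ∎)
    where
    regroup : ∀ y d Y J v → (y + d) * (y * Y + J * d * Y + d * d * v) ≈
              (y * (y * Y) + d * (y * Y)) + J * d * (y * Y) + d * d * (J * Y + v * (y + d))
    regroup = solve 5 (λ y d Y J v → (y :+ d) :* (y :* Y :+ J :* d :* Y :+ d :* d :* v) :=
      (y :* (y :* Y) :+ d :* (y :* Y)) :+ J :* d :* (y :* Y) :+ d :* d :* (J :* Y :+ v :* (y :+ d))) refl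
    ungroup : ∀ a d Y J o b → a + o * (d * Y) + J * d * Y + b ≈ a + (o + J) * d * Y + b
    ungroup = solve 6 (λ a d Y J o b → a :+ o :* (d :* Y) :+ J :* d :* Y :+ b := a :+ (o :+ J) :* d :* Y :+ b) refl
    step : ∀ y d Y J o v → d * (y * Y) ≈ o * (d * (y * Y)) →
           (y + d) * (y * Y + J * d * Y + d * d * v) ≈
           y * (y * Y) + (o + J) * d * (y * Y) + d * d * (J * Y + v * (y + d))
    step y d Y J o v eq = trans (regroup y d Y J v)
      (trans (+-congʳ (+-congʳ (+-congˡ eq))) (ungroup (y * (y * Y)) d (y * Y) J o _))

  module _ {q} (p-prime : Prime (suc q)) where

    private
      p = suc q
      P = p · 1#

    -- Only the two outer binomial coefficients are not multiples of p. As p need not vanish in `R`,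
    -- the error is kept as an explicit multiple of `P`, to be improved by taking further powers.
    freshman : ∀ s → ∃ λ w → (1# + s) ^ p ≈ (1# + s ^ p) + P * w
    freshman s = sum w , (begin
      (1# + s) ^ p                               ≈⟨ ^-congˡ p (+-comm 1# s) ⟩
      (s + 1#) ^ p                               ≈⟨ theorem p s 1# ⟩
      term 0 + sum tail                          ≈⟨ +-congˡ (sum-init-last tail) ⟩
      term 0 + (sum (tail ∘ inject₁) + tail (fromℕ q))
        ≈⟨ +-cong first (+-cong (trans (sum-cong-≋ middle) (sym (*-distribˡ-sum P w))) last) ⟩
      1# + (P * sum w + s ^ p)                   ≈⟨ +-congˡ (+-comm _ _) ⟩
      1# + (s ^ p + P * sum w)                   ≈⟨ +-assoc _ _ _ ⟨
      1# + s ^ p + P * sum w                     ∎)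
      where
      1^ : ∀ n → 1# ^ n ≈ 1#
      1^ zero    = refl
      1^ (suc n) = trans (*-identityˡ _) (1^ n)
      term : ℕ → Carrier
      term k = (p choose k) · (s ^ k * 1# ^ (p ℕ.∸ k))
      tail : Fin p → Carrier
      tail k = term (suc (toℕ k))
      first : term 0 ≈ 1#
      first = trans (+-identityʳ _) (trans (*-identityˡ _) (1^ p))
      last : tail (fromℕ q) ≈ s ^ p
      last = begin
        term (suc (toℕ (fromℕ q)))               ≡⟨ ≡.cong (term ∘ suc) (Finₚ.toℕ-fromℕ q) ⟩
        (p choose p) · (s ^ p * 1# ^ (q ℕ.∸ q))       ≡⟨ ≡.cong (_· (s ^ p * 1# ^ (q ℕ.∸ q))) (nCn≡1 p) ⟩
        1 · (s ^ p * 1# ^ (q ℕ.∸ q))             ≈⟨ +-identityʳ _ ⟩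
        s ^ p * 1# ^ (q ℕ.∸ q)                   ≈⟨ trans (*-congˡ (1^ (q ℕ.∸ q))) (*-identityʳ _) ⟩
        s ^ p                                    ∎
      p∣C : ∀ (k : Fin q) → p ∣ₙ (p choose suc (toℕ k))
      p∣C k = prime∣nCk p-prime (Finₚ.toℕ<n k)
      w : Fin q → Carrier
      w k = (quotient (p∣C k) · 1#) * (s ^ suc (toℕ k) * 1# ^ (q ℕ.∸ toℕ k))
      middle : ∀ k → tail (inject₁ k) ≈ P * w k
      middle k = begin
        term (suc (toℕ (inject₁ k)))             ≡⟨ ≡.cong (term ∘ suc) (Finₚ.toℕ-inject₁ k) ⟩
        (p choose suc (toℕ k)) · m                    ≡⟨ ≡.cong (_· m) (≡.trans (m∣n⇒n≡quotient*m (p∣C k)) (ℕₚ.*-comm (quotient (p∣C k)) p)) ⟩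
        (p ℕ.* quotient (p∣C k)) · m             ≈⟨ ×-congʳ (p ℕ.* quotient (p∣C k)) (*-identityˡ m) ⟨
        (p ℕ.* quotient (p∣C k)) · (1# * m)      ≈⟨ ×-assoc-* (p ℕ.* quotient (p∣C k)) 1# m ⟨
        (p ℕ.* quotient (p∣C k)) · 1# * m        ≈⟨ *-congʳ (×1-homo-* p (quotient (p∣C k))) ⟩
        P * (quotient (p∣C k) · 1#) * m          ≈⟨ *-assoc _ _ _ ⟩
        P * w k                                  ∎
        where m = s ^ suc (toℕ k) * 1# ^ (q ℕ.∸ toℕ k)

    -- In the expansion of `(y + d) ^ p` the linear term gains a factor p from its coefficient,
    -- while the rest is divisible by d^2, hence by p^(2k+2), and 2k + 2 is at least k + 2.
    power-step : ∀ k {x y w} → x ≈ y + P ^ suc k * w → ∃ λ w′ → x ^ p ≈ y ^ p + P ^ suc (suc k) * w′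
    power-step k {x} {y} {w} x≈ = let d = P ^ suc k * w ; v , eq = second-order y d q in
      w * y ^ q + P ^ k * w * w * v , (begin
      x ^ p                                          ≈⟨ ^-congˡ p x≈ ⟩
      (y + d) ^ p                                    ≈⟨ eq ⟩
      y ^ p + P * d * y ^ q + d * d * v              ≈⟨ regroup P (P ^ k) w (y ^ p) (y ^ q) v ⟩
      y ^ p + P ^ suc (suc k) * (w * y ^ q + P ^ k * w * w * v) ∎)
      where
      regroup : ∀ P Q w a b v → a + P * (P * Q * w) * b + P * Q * w * (P * Q * w) * v ≈
                                a + P * (P * Q) * (w * b + Q * w * w * v)
      regroup = solve 6 (λ P Q w a b v → a :+ P :* (P :* Q :* w) :* b :+ P :* Q :* w :* (P :* Q :* w) :* v :=
                                         a :+ P :* (P :* Q) :* (w :* b :+ Q :* w :* w :* v)) refl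

    power-lift : ∀ e k {x y w} → x ≈ y + P ^ suc k * w →
                 ∃ λ w′ → x ^ (p ℕ.^ e) ≈ y ^ (p ℕ.^ e) + P ^ suc (k ℕ.+ e) * w′
    power-lift zero k {x} {y} {w} x≈ = w , (begin
      x * 1#                                ≈⟨ *-identityʳ x ⟩
      x                                     ≈⟨ x≈ ⟩
      y + P ^ suc k * w                     ≈⟨ +-cong (*-identityʳ y) (*-congʳ (^-congʳ P (≡.cong suc (ℕₚ.+-identityʳ k)))) ⟨
      y * 1# + P ^ suc (k ℕ.+ 0) * w        ∎)
    power-lift (suc e) k {x} {y} {w} x≈ =
      let _ , x^p≈ = power-step k x≈ ; w′ , eq = power-lift e (suc k) x^p≈ in w′ , (begin
      x ^ (p ℕ.^ suc e)                           ≈⟨ ^-assocʳ x p (p ℕ.^ e) ⟨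
      (x ^ p) ^ (p ℕ.^ e)                         ≈⟨ eq ⟩
      (y ^ p) ^ (p ℕ.^ e) + P ^ suc (suc k ℕ.+ e) * w′
        ≈⟨ +-cong (^-assocʳ y p (p ℕ.^ e)) (*-congʳ (^-congʳ P (≡.cong suc (≡.sym (ℕₚ.+-suc k e))))) ⟩
      y ^ (p ℕ.^ suc e) + P ^ suc (k ℕ.+ suc e) * w′ ∎)

    -- The error p w of `freshman` becomes a multiple of p^(e+1) under the power p^e, and that is
    -- zero here. The exponent p^e will be the number of cycles of a translation.
    frobenius-lift : ∀ h → q ≡ h ℕ.* 2 → ∀ e → (p ℕ.^ suc e) · 1# ≈ 0# → ∀ s →
                     (1# + κ s q) ^ (p ℕ.^ e) ≈ (1# + s) ^ (p ℕ.^ suc e)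
    frobenius-lift h ≡.refl e p^e+1≈0 s =
      let w , fr = freshman s ; w′ , eq = power-lift e 0 {w = w} (trans fr (+-congˡ (*-congʳ (sym (*-identityʳ P))))) in
      sym (begin
      (1# + s) ^ (p ℕ.^ suc e)                            ≈⟨ ^-assocʳ (1# + s) p (p ℕ.^ e) ⟨
      ((1# + s) ^ p) ^ (p ℕ.^ e)                          ≈⟨ eq ⟩
      (1# + s ^ p) ^ (p ℕ.^ e) + P ^ suc e * w′           ≈⟨ +-congˡ (trans (*-congʳ (trans (sym (·1-homo-^ p (suc e))) p^e+1≈0)) (zeroˡ w′)) ⟩
      (1# + s ^ p) ^ (p ℕ.^ e) + 0#                       ≈⟨ +-identityʳ _ ⟩
      (1# + s ^ p) ^ (p ℕ.^ e)                            ≈⟨ ^-congˡ (p ℕ.^ e) (+-congˡ (κ-even s h)) ⟨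
      (1# + κ s q) ^ (p ℕ.^ e)                            ∎)

-- Powers of an element in a group of prime exponent

module PrimeExponent {a} {G : Set a} {_∙_ : G → G → G} {ε : G} {_⁻¹ : G → G}
  (isGroup : IsGroup _≡_ _∙_ ε _⁻¹) where

  open IsGroup isGroup using (identityˡ; identityʳ)

  group : Group a a
  group = record { isGroup = isGroup }

  open Algebra.Properties.Monoid.Mult (Group.monoid group) public renaming (_×_ to _·_)
  open Algebra.Properties.Loop (Algebra.Properties.Group.loop group) using (identityʳ-unique)

  ×-ε : ∀ m → m · ε ≡ ε
  ×-ε zero    = ≡.refl
  ×-ε (suc m) = ≡.trans (identityˡ _) (×-ε m)

  module _ {p} (pr : Prime p) (exponent : ∀ g → p · g ≡ ε) {g} (g≢ε : g ≢ ε) where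

    private
      multiple : ∀ {m} → m · g ≡ ε → ∀ x → (x ℕ.* m) · g ≡ ε
      multiple {m} mg≡ε x = ≡.trans (≡.sym (×-assocˡ g x m)) (≡.trans (≡.cong (x ·_) mg≡ε) (×-ε x))

      successor : ∀ {m n} → 1 ℕ.+ m ≡ n → m · g ≡ ε → n · g ≡ ε → g ≡ ε
      successor {m} ≡.refl mg≡ε ng≡ε = ≡.trans (≡.sym (identityʳ g)) (≡.trans (≡.cong (g ∙_) (≡.sym mg≡ε)) ng≡ε)

      -- Bézout provides a multiple of `d` and a multiple of `p` that are consecutive numbers; if
      -- both annihilate `g`, so does their difference 1.
      ×≢ε : ∀ {d} .{{_ : ℕ.NonZero d}} → d ℕ.< p → d · g ≢ ε
      ×≢ε {d} d<p dg≡ε with coprime-Bézout (prime⇒coprime pr d<p)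
      ... | Bézout.+- x y eq = g≢ε (successor eq (multiple dg≡ε y) (multiple (exponent g) x))
      ... | Bézout.-+ x y eq = g≢ε (successor eq (multiple (exponent g) x) (multiple dg≡ε y))

      ≤-case : ∀ {i j} → i ℕ.≤ j → j ℕ.< p → i · g ≡ j · g → i ≡ j
      ≤-case {i} {j} i≤j j<p eq with i ℕ.≟ j
      ... | yes i≡j = i≡j
      ... | no  i≢j = contradiction (identityʳ-unique (i · g) ((j ℕ.∸ i) · g) (≡.sym (≡.trans eq
              (≡.trans (≡.cong (_· g) (≡.sym (ℕₚ.m+[n∸m]≡n i≤j))) (×-homo-+ g i (j ℕ.∸ i))))))
              (×≢ε {{ℕ.>-nonZero (ℕₚ.m<n⇒0<n∸m (ℕₚ.≤∧≢⇒< i≤j i≢j))}} (ℕₚ.≤-<-trans (ℕₚ.m∸n≤m j i) j<p))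

    ×-injective : ∀ {i j} → i ℕ.< p → j ℕ.< p → i · g ≡ j · g → i ≡ j
    ×-injective {i} {j} i<p j<p eq with ℕₚ.≤-total i j
    ... | inj₁ i≤j = ≤-case i≤j j<p eq
    ... | inj₂ j≤i = ≡.sym (≤-case j≤i i<p (≡.sym eq))

-- Group determinants of elements close to the identity

module GroupDeterminant {c ℓ} (R : CommutativeRing c ℓ)
  {n} {_∙_ : Fin n → Fin n → Fin n} {ε : Fin n} {_⁻¹ : Fin n → Fin n} (isGroup : IsGroup _≡_ _∙_ ε _⁻¹)
  where

  open CommutativeRing R hiding (zero)
  open Algebra.Properties.Semiring.Exp semiring
  open Algebra.Properties.CommutativeSemiring.Exp commutativeSemiring using (^-distrib-*)
  open Algebra.Properties.Semiring.Mult semiring using () renaming (_×_ to _·_)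
  open Algebra.Properties.Semiring.Sum semiring
  open Relation.Binary.Reasoning.Setoid setoid
  open Algebra.Solver.Ring.NaturalCoefficients.Default commutativeSemiring using (solve; _:=_; _:+_; _:*_)
  open Determinant R
  open RowCycles R using (κ)
  open FreeRotation R
  open FrobeniusLift R
  open PrimeExponent isGroup using (group) renaming (_·_ to _·ᵍ_)
  module G = Group group
  open Algebra.Properties.Group group using (x∙y⁻¹≈ε⇒x≈y)
  open Algebra.Properties.Quasigroup (Algebra.Properties.Group.quasigroup group) using (cancelˡ; cancelʳ)

  -- The matrix of left multiplication by `a` on the group ring.
  convolutionMatrix : (Fin n → Carrier) → Matrix n
  convolutionMatrix a r s = a (r ∙ (s ⁻¹))

  δ : Fin n → Carrier
  δ x = if does (x Finₚ.≟ ε) then 1# else 0#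

  δ-ε : ∀ {x} → x ≡ ε → δ x ≡ 1#
  δ-ε {x} x≡ε rewrite dec-true (x Finₚ.≟ ε) x≡ε = ≡.refl

  δ-≢ : ∀ {x} → x ≢ ε → δ x ≡ 0#
  δ-≢ {x} x≢ε rewrite dec-false (x Finₚ.≟ ε) x≢ε = ≡.refl

  convolutionMatrix-δ : ∀ r s → convolutionMatrix δ r s ≈ identity n r s
  convolutionMatrix-δ r s with r Finₚ.≟ s
  ... | yes ≡.refl = reflexive (≡.trans (δ-ε (G.inverseʳ r)) (≡.sym (identity-diagonal n r)))
  ... | no r≢s     = reflexive (≡.trans (δ-≢ (r≢s ∘ x∙y⁻¹≈ε⇒x≈y r s)) (≡.sym (identity-off-diagonal n r≢s)))

  -- The coefficients of (1 + s g⁻¹) a.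
  twist : Fin n → Carrier → (Fin n → Carrier) → Fin n → Carrier
  twist g s a x = a x + s * a (g ∙ x)

  sum-twist : ∀ g s a → sum (twist g s a) ≈ (1# + s) * sum a
  sum-twist g s a = begin
    sum (twist g s a)                          ≈⟨ ∑-distrib-+ a (λ x → s * a (g ∙ x)) ⟩
    sum a + sum (λ x → s * a (g ∙ x))          ≈⟨ +-congˡ (*-distribˡ-sum s (λ x → a (g ∙ x))) ⟨
    sum a + s * sum (λ x → a (g ∙ x))          ≈⟨ +-congˡ (*-congˡ (sum-permute a translation)) ⟨
    sum a + s * sum a                          ≈⟨ +-congʳ (*-identityˡ _) ⟨
    1# * sum a + s * sum a                     ≈⟨ distribʳ _ 1# s ⟨
    (1# + s) * sum a                           ∎
    where
    translation : Permutation n n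
    translation = permutation (g ∙_) ((g ⁻¹) ∙_)
      (λ x → ≡.trans (≡.sym (G.assoc g (g ⁻¹) x)) (≡.trans (≡.cong (_∙ x) (G.inverseʳ g)) (G.identityˡ x)))
      (λ x → ≡.trans (≡.sym (G.assoc (g ⁻¹) g x)) (≡.trans (≡.cong (_∙ x) (G.inverseˡ g)) (G.identityˡ x)))

  module _ {q} (p-prime : Prime (suc q)) (h : ℕ) (q≡2h : q ≡ h ℕ.* 2) (e : ℕ)
    (order : n ≡ suc q ℕ.^ suc e) (n≈0 : n · 1# ≈ 0#) (exponent : ∀ g → suc q ·ᵍ g ≡ ε)
    where

    private
      p = suc q

    iterate-translation : ∀ g j x → iterate (g ∙_) j x ≡ (j ·ᵍ g) ∙ x
    iterate-translation g zero    x = ≡.sym (G.identityˡ x)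
    iterate-translation g (suc j) x = ≡.trans (≡.cong (g ∙_) (iterate-translation g j x)) (≡.sym (G.assoc g _ x))

    -- Row `r` of the twisted matrix is row `r` plus `s` times row `g ∙ r`, so the rows combine
    -- along translation by `g`. For `g` equal to `ε` this translation is not free, but then the
    -- whole matrix is scaled by 1 + s.
    Det-twist : ∀ g s a → Det n (convolutionMatrix (twist g s a)) ≈ (1# + s) ^ n * Det n (convolutionMatrix a)
    Det-twist g s a with g Finₚ.≟ ε
    ... | yes ≡.refl = trans
      (Det-cong n λ r x → begin
        a (r ∙ (x ⁻¹)) + s * a (ε ∙ (r ∙ (x ⁻¹)))      ≈⟨ +-cong (sym (*-identityˡ _)) (*-congˡ (reflexive (≡.cong a (G.identityˡ _)))) ⟩
        1# * a (r ∙ (x ⁻¹)) + s * a (r ∙ (x ⁻¹))       ≈⟨ distribʳ _ 1# s ⟨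
        (1# + s) * a (r ∙ (x ⁻¹))                      ∎)
      (Det-scale n (1# + s) (convolutionMatrix a))
    ... | no g≢ε = let k , kp≡n , eq = Det-rotation (g ∙_) q periodic free (convolutionMatrix a) s in begin
      Det n (convolutionMatrix (twist g s a))                ≈⟨ Det-cong n (λ r x → +-congˡ (*-congˡ (reflexive (≡.cong a (≡.sym (G.assoc g r (x ⁻¹))))))) ⟩
      Det n (λ r x → convolutionMatrix a r x + s * convolutionMatrix a (g ∙ r) x) ≈⟨ eq ⟩
      (1# + κ s q) ^ k * Det n (convolutionMatrix a)         ≈⟨ *-congʳ (^-congʳ (1# + κ s q) (k≡p^e k kp≡n)) ⟩
      (1# + κ s q) ^ (p ℕ.^ e) * Det n (convolutionMatrix a) ≈⟨ *-congʳ (frobenius-lift p-prime h q≡2h e (≡.subst (λ m → m · 1# ≈ 0#) order n≈0) s) ⟩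
      (1# + s) ^ (p ℕ.^ suc e) * Det n (convolutionMatrix a) ≈⟨ *-congʳ (^-congʳ (1# + s) order) ⟨
      (1# + s) ^ n * Det n (convolutionMatrix a)             ∎
      where
      periodic : ∀ x → iterate (g ∙_) p x ≡ x
      periodic x = ≡.trans (iterate-translation g p x) (≡.trans (≡.cong (_∙ x) (exponent g)) (G.identityˡ x))
      free : ∀ {i j} → i ℕ.≤ q → j ℕ.≤ q → ∀ x → iterate (g ∙_) i x ≡ iterate (g ∙_) j x → i ≡ j
      free {i} {j} i≤q j≤q x eq = PrimeExponent.×-injective isGroup p-prime exponent g≢ε (s≤s i≤q) (s≤s j≤q)
        (cancelʳ x (i ·ᵍ g) (j ·ᵍ g) (≡.trans (≡.sym (iterate-translation g i x)) (≡.trans eq (iterate-translation g j x))))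
      k≡p^e : ∀ k → k ℕ.* p ≡ n → k ≡ p ℕ.^ e
      k≡p^e k kp≡n = ℕₚ.*-cancelʳ-≡ k (p ℕ.^ e) p (≡.trans kp≡n (≡.trans order (ℕₚ.*-comm p (p ℕ.^ e))))

    module _ (t : Carrier) (M : ℕ) (t^M≈0 : t ^ M ≈ 0#) where

      private
        Close : ℕ → Carrier → Carrier → Set _
        Close m x y = ∃ λ w → x ≈ y + t ^ m * w

        Power : (Fin n → Carrier) → Set _
        Power a = Det n (convolutionMatrix a) ≈ sum a ^ n

        -- `u` is the partial sum of the first `m` powers of -s, and `v` is the sign of the
        -- remainder.
        geometric : ∀ s m → ∃ λ u → ∃ λ v → u * (1# + s) ≈ 1# + v * s ^ m
        geometric s zero    = 0# , - 1# , trans (zeroˡ _) (sym (trans (+-congˡ (*-identityʳ _)) (-‿inverseʳ 1#)))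
        geometric s (suc m) = let u , v , eq = geometric s m in u + - v * s ^ m , - v , (begin
          (u + - v * s ^ m) * (1# + s)                     ≈⟨ distribʳ _ u _ ⟩
          u * (1# + s) + - v * s ^ m * (1# + s)            ≈⟨ +-cong eq (trans (distribˡ _ 1# s) (+-congʳ (*-identityʳ _))) ⟩
          1# + v * s ^ m + (- v * s ^ m + - v * s ^ m * s) ≈⟨ trans (+-assoc _ _ _) (+-congˡ (sym (+-assoc _ _ _))) ⟩
          1# + (v * s ^ m + - v * s ^ m + - v * s ^ m * s)
            ≈⟨ +-congˡ (+-cong (trans (sym (distribʳ _ v (- v))) (trans (*-congʳ (-‿inverseʳ v)) (zeroˡ _)))
                               (trans (*-assoc _ _ _) (*-congˡ (*-comm _ s)))) ⟩
          1# + (0# + - v * s ^ suc m)                      ≈⟨ +-congˡ (+-identityˡ _) ⟩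
          1# + - v * s ^ suc m                             ∎)

        unit : ∀ z → ∃ λ u → u * (1# + t * z) ≈ 1#
        unit z = let u , v , eq = geometric (t * z) M in u , (begin
          u * (1# + t * z)           ≈⟨ eq ⟩
          1# + v * (t * z) ^ M       ≈⟨ +-congˡ (*-congˡ (trans (^-distrib-* t z M) (trans (*-congʳ t^M≈0) (zeroˡ _)))) ⟩
          1# + v * 0#                ≈⟨ trans (+-congˡ (zeroʳ v)) (+-identityʳ 1#) ⟩
          1#                         ∎)

        1^ : ∀ m → 1# ^ m ≈ 1#
        1^ zero    = refl
        1^ (suc m) = trans (*-identityˡ _) (1^ m)

        -- A twist multiplies both sides of `Power` by `(1# + s) ^ n`; nilpotency of `t` makes this
        -- a unit, so it can be cancelled.
        untwist : ∀ g z a → Power (twist g (t * z) a) → Power a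
        untwist g z a power = let s = t * z ; u , u-inverse = unit z in begin
          Det n (convolutionMatrix a)                            ≈⟨ cancel u s u-inverse _ ⟨
          u ^ n * ((1# + s) ^ n * Det n (convolutionMatrix a))   ≈⟨ *-congˡ (Det-twist g s a) ⟨
          u ^ n * Det n (convolutionMatrix (twist g s a))        ≈⟨ *-congˡ power ⟩
          u ^ n * sum (twist g s a) ^ n                    ≈⟨ *-congˡ (^-congˡ n (sum-twist g s a)) ⟩
          u ^ n * ((1# + s) * sum a) ^ n                   ≈⟨ *-congˡ (^-distrib-* _ _ n) ⟩
          u ^ n * ((1# + s) ^ n * sum a ^ n)               ≈⟨ cancel u s u-inverse _ ⟩
          sum a ^ n                                        ∎
          where
          cancel : ∀ u s → u * (1# + s) ≈ 1# → ∀ x → u ^ n * ((1# + s) ^ n * x) ≈ x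
          cancel u s u-inverse x = begin
            u ^ n * ((1# + s) ^ n * x)     ≈⟨ *-assoc _ _ _ ⟨
            u ^ n * (1# + s) ^ n * x       ≈⟨ *-congʳ (^-distrib-* u (1# + s) n) ⟨
            (u * (1# + s)) ^ n * x         ≈⟨ *-congʳ (trans (^-congˡ n u-inverse) (1^ n)) ⟩
            1# * x                         ≈⟨ *-identityˡ x ⟩
            x                              ∎

        sum-identity : ∀ n i → sum (identity n i) ≈ 1#
        sum-identity (suc n) zero    = trans (+-congˡ (sum-replicate-zero n)) (+-identityʳ 1#)
        sum-identity (suc n) (suc i) = trans (+-identityˡ _) (sum-identity n i)

        Power-δ : ∀ {a} → (∀ x → a x ≈ δ x) → Power a
        Power-δ {a} a≈δ = begin
          Det n (convolutionMatrix a)    ≈⟨ Det-cong n (λ r x → trans (a≈δ _) (convolutionMatrix-δ r x)) ⟩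
          Det n (identity n)       ≈⟨ Det-identity n ⟩
          1#                       ≈⟨ 1^ n ⟨
          1# ^ n                   ≈⟨ ^-congˡ n (trans (sum-cong-≋ (λ x → trans (a≈δ x) (δ-identity x))) (sum-identity n ε)) ⟨
          sum a ^ n                ∎
          where
          δ-identity : ∀ x → δ x ≈ identity n ε x
          δ-identity x with x Finₚ.≟ ε
          ... | yes ≡.refl = reflexive (≡.sym (identity-diagonal n x))
          ... | no  x≢ε    = reflexive (≡.sym (identity-off-diagonal n (x≢ε ∘ ≡.sym)))

        -- Multiplying by 1 - tᵐ⁺¹ w x₀ removes the coefficient of tᵐ⁺¹ at x₀ and
        -- leaves the others unchanged modulo tᵐ⁺².
        clear : ∀ m (x₀ : Fin n) a → (∀ x → Close (suc m) (a x) (δ x)) →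
                ∃ λ z → let a′ = twist (x₀ ⁻¹) (t * z) a in
                Close (suc (suc m)) (a′ x₀) (δ x₀) ×
                (∀ x → x ≢ x₀ → Close (suc (suc m)) (a′ x) (a x))
        clear m x₀ a close = z , (z * v ε , at-x₀) , λ x x≢x₀ → z * v (g ∙ x) , elsewhere x x≢x₀
          where
          -- This makes `a (g ∙ x₀)` the coefficient at `ε`, which is 1 up to order `suc m`; the
          -- choice of `z` then cancels the error at `x₀`. For other `x` the added coefficient
          -- already has order `suc m`, and the factor `t` in front of `z` raises it by one.
          g = x₀ ⁻¹
          v : Fin n → Carrier
          v x = proj₁ (close x)
          z = - (t ^ m * v x₀)
          regroup : ∀ d t T w z o v → d + t * T * w + t * z * (o + t * T * v) ≈
                    d + t * (T * w + z * o) + t * (t * T) * (z * v)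
          regroup = solve 7 (λ d t T w z o v → d :+ t :* T :* w :+ t :* z :* (o :+ t :* T :* v) :=
                             d :+ t :* (T :* w :+ z :* o) :+ t :* (t :* T) :* (z :* v)) refl
          at-x₀ : a x₀ + t * z * a (g ∙ x₀) ≈ δ x₀ + t ^ suc (suc m) * (z * v ε)
          at-x₀ = begin
            a x₀ + t * z * a (g ∙ x₀)
              ≈⟨ +-cong (proj₂ (close x₀)) (*-congˡ (trans (reflexive (≡.cong a (G.inverseˡ x₀)))
                   (trans (proj₂ (close ε)) (+-congʳ (reflexive (δ-ε ≡.refl)))))) ⟩
            δ x₀ + t ^ suc m * v x₀ + t * z * (1# + t ^ suc m * v ε)
              ≈⟨ regroup (δ x₀) t (t ^ m) (v x₀) z 1# (v ε) ⟩
            δ x₀ + t * (t ^ m * v x₀ + z * 1#) + t ^ suc (suc m) * (z * v ε)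
              ≈⟨ +-congʳ (trans (+-congˡ (trans (*-congˡ (trans (+-congˡ (*-identityʳ z)) (-‿inverseʳ _))) (zeroʳ t)))
                                (+-identityʳ _)) ⟩
            δ x₀ + t ^ suc (suc m) * (z * v ε) ∎
          g∙x≢ε : ∀ {x} → x ≢ x₀ → g ∙ x ≢ ε
          g∙x≢ε x≢x₀ gx≡ε = x≢x₀ (cancelˡ g _ _ (≡.trans gx≡ε (≡.sym (G.inverseˡ x₀))))
          move : ∀ t z T v → t * z * (t * T * v) ≈ t * (t * T) * (z * v)
          move = solve 4 (λ t z T v → t :* z :* (t :* T :* v) := t :* (t :* T) :* (z :* v)) refl
          elsewhere : ∀ x → x ≢ x₀ → a x + t * z * a (g ∙ x) ≈ a x + t ^ suc (suc m) * (z * v (g ∙ x))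
          elsewhere x x≢x₀ = +-congˡ (trans
            (*-congˡ (trans (proj₂ (close (g ∙ x)))
                     (trans (+-congʳ (reflexive (δ-≢ (g∙x≢ε x≢x₀)))) (+-identityˡ _))))
            (move t z (t ^ m) (v (g ∙ x))))

        Close-trans : ∀ m {x y z} → Close m x y → Close m y z → Close m x z
        Close-trans m (w , eq) (w′ , eq′) = w′ + w ,
          trans eq (trans (+-congʳ eq′) (trans (+-assoc _ _ _) (+-congˡ (sym (distribˡ (t ^ m) w′ w)))))

        Close-weaken : ∀ m {x y} → Close (suc m) x y → Close m x y
        Close-weaken m (w , eq) = t * w , trans eq (+-congˡ (trans (*-congʳ (*-comm t _)) (*-assoc _ t w)))

        -- Positions are cleared from the last to the first: those with index at least `k` already
        -- have the better order, and clearing position `k - 1` leaves them accurate.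
        clear-from : ∀ m → (∀ a → (∀ x → Close (suc (suc m)) (a x) (δ x)) → Power a) →
                     ∀ k → k ℕ.≤ n → ∀ a → (∀ x → Close (suc m) (a x) (δ x)) →
                     (∀ x → k ℕ.≤ toℕ x → Close (suc (suc m)) (a x) (δ x)) → Power a
        clear-from m power zero    _   a _     cleared = power a (λ x → cleared x z≤n)
        clear-from m power (suc k) k<n a close cleared =
          let z , at-x₀ , elsewhere = clear m x₀ a close
              x≟x₀ = λ x → x Finₚ.≟ x₀
          in untwist (x₀ ⁻¹) z a (clear-from m power k (ℕₚ.<⇒≤ k<n) _
            (λ x → all x (x≟x₀ x) at-x₀ elsewhere)
            (λ x k≤x → beyond x k≤x (x≟x₀ x) at-x₀ elsewhere))
          where
          x₀ = fromℕ< k<n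
          all : ∀ x {a′ : Fin n → Carrier} → Dec (x ≡ x₀) → Close (suc (suc m)) (a′ x₀) (δ x₀) →
                (∀ x → x ≢ x₀ → Close (suc (suc m)) (a′ x) (a x)) → Close (suc m) (a′ x) (δ x)
          all x (yes ≡.refl) at _ = Close-weaken (suc m) at
          all x (no x≢x₀)    _  el = Close-trans (suc m) (Close-weaken (suc m) (el x x≢x₀)) (close x)
          beyond : ∀ x {a′ : Fin n → Carrier} → k ℕ.≤ toℕ x → Dec (x ≡ x₀) → Close (suc (suc m)) (a′ x₀) (δ x₀) →
                   (∀ x → x ≢ x₀ → Close (suc (suc m)) (a′ x) (a x)) → Close (suc (suc m)) (a′ x) (δ x)
          beyond x k≤x (yes ≡.refl) at _  = at
          beyond x k≤x (no x≢x₀)    _  el = Close-trans (suc (suc m)) (el x x≢x₀) (cleared x (ℕₚ.≤∧≢⇒< k≤x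
            λ k≡x → x≢x₀ (Finₚ.toℕ-injective (≡.trans (≡.sym k≡x) (≡.sym (Finₚ.toℕ-fromℕ< k<n))))))

        -- `d` counts the orders of `t` still to be cleared; when none is left, `t ^ M` is zero and
        -- `a` equals `δ`.
        close⇒power : ∀ d m → d ℕ.+ suc m ≡ M → ∀ a → (∀ x → Close (suc m) (a x) (δ x)) → Power a
        close⇒power zero    m ≡.refl a close = Power-δ λ x → trans (proj₂ (close x))
          (trans (+-congˡ (trans (*-congʳ t^M≈0) (zeroˡ _))) (+-identityʳ _))
        close⇒power (suc d) m d+m≡M a close =
          clear-from m (close⇒power d (suc m) (≡.trans (ℕₚ.+-suc d (suc m)) d+m≡M)) n ℕₚ.≤-refl a close
            λ x n≤x → contradiction (Finₚ.toℕ<n x) (ℕₚ.≤⇒≯ n≤x)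

      group-determinant : 0 ℕ.< M → ∀ (F : Fin n → Carrier) →
        Det n (convolutionMatrix (λ x → δ x + t * F x)) ≈ sum (λ x → δ x + t * F x) ^ n
      group-determinant 0<M F = close⇒power (M ℕ.∸ 1) 0 (ℕₚ.m∸n+n≡m 0<M) (λ x → δ x + t * F x)
        λ x → F x , +-congˡ (*-congʳ (sym (*-identityʳ t)))

open import Defs

-- Quotient of a ring by two elements

module Quotient {c ℓ} (R : CommutativeRing c ℓ) (a b : CommutativeRing.Carrier R) where

  open CommutativeRing R
  open Algebra.Properties.Ring ring
  open Relation.Binary.Reasoning.Setoid setoid
  open Algebra.Solver.Ring.NaturalCoefficients.Default commutativeSemiring using (solve; _:=_; _:+_; _:*_)

  infix 4 _∼_

  -- Only the equality is weakened: elements and operations stay those of `R`. Coefficients of a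
  -- series can therefore be read off in the quotient, and the witnesses turn a congruence back into
  -- an equation.
  _∼_ : Carrier → Carrier → Set _
  x ∼ y = ∃ λ u → ∃ λ v → x ≈ y + (a * u + b * v)

  private
    ≈⇒∼ : ∀ {x y} → x ≈ y → x ∼ y
    ≈⇒∼ {x} {y} x≈y = 0# , 0# , (begin
      x                          ≈⟨ x≈y ⟩
      y                          ≈⟨ +-identityʳ y ⟨
      y + 0#                     ≈⟨ +-congˡ (trans (+-cong (zeroʳ a) (zeroʳ b)) (+-identityʳ 0#)) ⟨
      y + (a * 0# + b * 0#)      ∎)

    cancel : ∀ u → a * u + a * (- u) ≈ 0#
    cancel u = trans (sym (distribˡ a u (- u))) (trans (*-congˡ (-‿inverseʳ u)) (zeroʳ a))

    negate : ∀ u v → - (a * u + b * v) ≈ a * (- u) + b * (- v)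
    negate u v = trans (sym (-‿+-comm _ _)) (+-cong (-‿distribʳ-* a u) (-‿distribʳ-* b v))

    ∼-sym : ∀ {x y} → x ∼ y → y ∼ x
    ∼-sym {x} {y} (u , v , eq) = - u , - v , (begin
      y                                                        ≈⟨ +-identityʳ y ⟨
      y + 0#                                                   ≈⟨ +-congˡ (-‿inverseʳ d) ⟨
      y + (d + - d)                                            ≈⟨ +-assoc y d (- d) ⟨
      y + d + - d                                              ≈⟨ +-cong (sym eq) (negate u v) ⟩
      x + (a * - u + b * - v)                                  ∎)
      where d = a * u + b * v

    ∼-trans : ∀ {x y z} → x ∼ y → y ∼ z → x ∼ z
    ∼-trans {x} {y} {z} (u , v , eq) (u′ , v′ , eq′) = u′ + u , v′ + v ,
      trans eq (trans (+-congʳ eq′) (regroup a b z u v u′ v′))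
      where
      regroup : ∀ a b z u v u′ v′ → z + (a * u′ + b * v′) + (a * u + b * v) ≈ z + (a * (u′ + u) + b * (v′ + v))
      regroup = solve 7 (λ a b z u v u′ v′ → z :+ (a :* u′ :+ b :* v′) :+ (a :* u :+ b :* v) :=
                                             z :+ (a :* (u′ :+ u) :+ b :* (v′ :+ v))) refl

    ∼-+ : ∀ {x y x′ y′} → x ∼ y → x′ ∼ y′ → x + x′ ∼ y + y′
    ∼-+ {x} {y} {x′} {y′} (u , v , eq) (u′ , v′ , eq′) = u + u′ , v + v′ ,
      trans (+-cong eq eq′) (regroup a b y y′ u v u′ v′)
      where
      regroup : ∀ a b y y′ u v u′ v′ → (y + (a * u + b * v)) + (y′ + (a * u′ + b * v′)) ≈
                                       y + y′ + (a * (u + u′) + b * (v + v′))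
      regroup = solve 8 (λ a b y y′ u v u′ v′ → (y :+ (a :* u :+ b :* v)) :+ (y′ :+ (a :* u′ :+ b :* v′)) :=
                                                y :+ y′ :+ (a :* (u :+ u′) :+ b :* (v :+ v′))) refl

    ∼-neg : ∀ {x y} → x ∼ y → - x ∼ - y
    ∼-neg {x} {y} (u , v , eq) = - u , - v ,
      trans (-‿cong eq) (trans (sym (-‿+-comm y _)) (+-congˡ (negate u v)))

    ∼-* : ∀ {x y x′ y′} → x ∼ y → x′ ∼ y′ → x * x′ ∼ y * y′
    ∼-* {x} {y} {x′} {y′} (u , v , eq) (u′ , v′ , eq′) = u * x′ + y * u′ , v * x′ + y * v′ , (begin
      x * x′                                                    ≈⟨ *-congʳ eq ⟩
      (y + (a * u + b * v)) * x′                                ≈⟨ distribʳ x′ y _ ⟩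
      y * x′ + (a * u + b * v) * x′                             ≈⟨ +-congʳ (*-congˡ eq′) ⟩
      y * (y′ + (a * u′ + b * v′)) + (a * u + b * v) * x′       ≈⟨ regroup a b y y′ x′ u v u′ v′ ⟩
      y * y′ + (a * (u * x′ + y * u′) + b * (v * x′ + y * v′))  ∎)
      where
      regroup : ∀ a b y y′ x′ u v u′ v′ → y * (y′ + (a * u′ + b * v′)) + (a * u + b * v) * x′ ≈
                                          y * y′ + (a * (u * x′ + y * u′) + b * (v * x′ + y * v′))
      regroup = solve 9 (λ a b y y′ x′ u v u′ v′ → y :* (y′ :+ (a :* u′ :+ b :* v′)) :+ (a :* u :+ b :* v) :* x′ :=
        y :* y′ :+ (a :* (u :* x′ :+ y :* u′) :+ b :* (v :* x′ :+ y :* v′))) refl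

  quotientRing : CommutativeRing _ _
  quotientRing = record
    { Carrier = Carrier
    ; _≈_ = _∼_
    ; _+_ = _+_
    ; _*_ = _*_
    ; -_ = -_
    ; 0# = 0#
    ; 1# = 1#
    ; isCommutativeRing = record
      { isRing = record
        { +-isAbelianGroup = record
          { isGroup = record
            { isMonoid = record
              { isSemigroup = record
                { isMagma = record
                  { isEquivalence = record { refl = ≈⇒∼ refl ; sym = ∼-sym ; trans = ∼-trans }
                  ; ∙-cong = ∼-+ }
                ; assoc = λ x y z → ≈⇒∼ (+-assoc x y z) }
              ; identity = (λ x → ≈⇒∼ (+-identityˡ x)) , (λ x → ≈⇒∼ (+-identityʳ x)) }
            ; inverse = (λ x → ≈⇒∼ (-‿inverseˡ x)) , (λ x → ≈⇒∼ (-‿inverseʳ x))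
            ; ⁻¹-cong = ∼-neg }
          ; comm = λ x y → ≈⇒∼ (+-comm x y) }
        ; *-cong = ∼-*
        ; *-assoc = λ x y z → ≈⇒∼ (*-assoc x y z)
        ; *-identity = (λ x → ≈⇒∼ (*-identityˡ x)) , (λ x → ≈⇒∼ (*-identityʳ x))
        ; distrib = (λ x y z → ≈⇒∼ (distribˡ x y z)) , (λ x y z → ≈⇒∼ (distribʳ x y z)) }
      ; *-comm = λ x y → ≈⇒∼ (*-comm x y) } }

-- Integer power series and leading coefficients

module PowerSeries where

  open ≡.≡-Reasoning

  Series : Set
  Series = ℕ → ℤ

  infixl 7 _⊛_
  infixl 6 _⊕_

  _⊕_ : Series → Series → Series
  (f ⊕ g) n = f n ℤ.+ g n

  ⊖_ : Series → Series
  (⊖ f) n = ℤ.- f n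

  const : ℤ → Series
  const c zero    = c
  const c (suc n) = + 0

  _⊛_ : Series → Series → Series
  (f ⊛ g) zero    = f 0 ℤ.* g 0
  (f ⊛ g) (suc n) = f 0 ℤ.* g (suc n) ℤ.+ ((f ∘ suc) ⊛ g) n

  X : Series
  X zero    = + 0
  X (suc n) = const (+ 1) n

  ⊛-cong : ∀ {f f′ g g′} → (∀ n → f n ≡ f′ n) → (∀ n → g n ≡ g′ n) → ∀ n → (f ⊛ g) n ≡ (f′ ⊛ g′) n
  ⊛-cong f≡ g≡ zero    = ≡.cong₂ ℤ._*_ (f≡ 0) (g≡ 0)
  ⊛-cong f≡ g≡ (suc n) = ≡.cong₂ ℤ._+_ (≡.cong₂ ℤ._*_ (f≡ 0) (g≡ (suc n))) (⊛-cong (f≡ ∘ suc) g≡ n)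

  ⊛-zeroˡ : ∀ f → (∀ n → f n ≡ + 0) → ∀ g n → (f ⊛ g) n ≡ + 0
  ⊛-zeroˡ f f≡0 g zero    = ≡.cong (ℤ._* g 0) (f≡0 0)
  ⊛-zeroˡ f f≡0 g (suc n) = ≡.cong₂ ℤ._+_ (≡.cong (ℤ._* g (suc n)) (f≡0 0)) (⊛-zeroˡ (f ∘ suc) (f≡0 ∘ suc) g n)

  ⊛-distribʳ : ∀ h f g n → ((f ⊕ g) ⊛ h) n ≡ (f ⊛ h ⊕ g ⊛ h) n
  ⊛-distribʳ h f g zero    = ℤₚ.*-distribʳ-+ (h 0) (f 0) (g 0)
  ⊛-distribʳ h f g (suc n) = ≡.trans (≡.cong (λ z → (f 0 ℤ.+ g 0) ℤ.* h (suc n) ℤ.+ z) (⊛-distribʳ h (f ∘ suc) (g ∘ suc) n))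
    (regroup (f 0) (g 0) (h (suc n)) _ _)
    where
    regroup : ∀ a b c d e → (a ℤ.+ b) ℤ.* c ℤ.+ (d ℤ.+ e) ≡ (a ℤ.* c ℤ.+ d) ℤ.+ (b ℤ.* c ℤ.+ e)
    regroup = ℤ-Solver.solve-∀

  -- The product is defined by splitting off the lowest coefficient of the left factor; splitting
  -- off that of the right factor gives the mirrored recursion, from which commutativity follows.
  ⊛-last : ∀ f g n → (f ⊛ g) (suc n) ≡ (f ⊛ (g ∘ suc)) n ℤ.+ f (suc n) ℤ.* g 0
  ⊛-last f g zero    = ≡.refl
  ⊛-last f g (suc n) = ≡.trans (≡.cong (λ z → f 0 ℤ.* g (suc (suc n)) ℤ.+ z) (⊛-last (f ∘ suc) g n))
                               (≡.sym (ℤₚ.+-assoc (f 0 ℤ.* g (suc (suc n))) _ _))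

  ⊛-comm : ∀ f g n → (f ⊛ g) n ≡ (g ⊛ f) n
  ⊛-comm f g zero    = ℤₚ.*-comm (f 0) (g 0)
  ⊛-comm f g (suc n) = begin
    f 0 ℤ.* g (suc n) ℤ.+ ((f ∘ suc) ⊛ g) n ≡⟨ ≡.cong₂ ℤ._+_ (ℤₚ.*-comm (f 0) _) (⊛-comm (f ∘ suc) g n) ⟩
    g (suc n) ℤ.* f 0 ℤ.+ (g ⊛ (f ∘ suc)) n ≡⟨ ℤₚ.+-comm (g (suc n) ℤ.* f 0) _ ⟩
    (g ⊛ (f ∘ suc)) n ℤ.+ g (suc n) ℤ.* f 0 ≡⟨ ⊛-last g f n ⟨
    (g ⊛ f) (suc n)                         ∎

  ⊛-scaleˡ : ∀ c f g n → ((λ k → c ℤ.* f k) ⊛ g) n ≡ c ℤ.* (f ⊛ g) n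
  ⊛-scaleˡ c f g zero    = ℤₚ.*-assoc c (f 0) (g 0)
  ⊛-scaleˡ c f g (suc n) = ≡.trans (≡.cong (λ z → c ℤ.* f 0 ℤ.* g (suc n) ℤ.+ z) (⊛-scaleˡ c (f ∘ suc) g n))
                                   (regroup c (f 0) (g (suc n)) _)
    where
    regroup : ∀ c a b d → c ℤ.* a ℤ.* b ℤ.+ c ℤ.* d ≡ c ℤ.* (a ℤ.* b ℤ.+ d)
    regroup = ℤ-Solver.solve-∀

  ⊛-assoc : ∀ f g h n → ((f ⊛ g) ⊛ h) n ≡ (f ⊛ (g ⊛ h)) n
  ⊛-assoc f g h zero    = ℤₚ.*-assoc (f 0) (g 0) (h 0)
  ⊛-assoc f g h (suc n) = begin
    -- The shift of `f ⊛ g` is by definition `f 0` times the shift of `g`, plus `(f ∘ suc) ⊛ g`.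
    f 0 ℤ.* g 0 ℤ.* h (suc n) ℤ.+ (((λ k → f 0 ℤ.* g (suc k)) ⊕ ((f ∘ suc) ⊛ g)) ⊛ h) n
      ≡⟨ ≡.cong (λ z → f 0 ℤ.* g 0 ℤ.* h (suc n) ℤ.+ z) (≡.trans (⊛-distribʳ h (λ k → f 0 ℤ.* g (suc k)) ((f ∘ suc) ⊛ g) n)
           (≡.cong₂ ℤ._+_ (⊛-scaleˡ (f 0) (g ∘ suc) h n) (⊛-assoc (f ∘ suc) g h n))) ⟩
    f 0 ℤ.* g 0 ℤ.* h (suc n) ℤ.+ (f 0 ℤ.* ((g ∘ suc) ⊛ h) n ℤ.+ ((f ∘ suc) ⊛ (g ⊛ h)) n)
      ≡⟨ regroup (f 0) (g 0) (h (suc n)) _ _ ⟩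
    f 0 ℤ.* (g 0 ℤ.* h (suc n) ℤ.+ ((g ∘ suc) ⊛ h) n) ℤ.+ ((f ∘ suc) ⊛ (g ⊛ h)) n ∎
    where
    regroup : ∀ a b c d e → a ℤ.* b ℤ.* c ℤ.+ (a ℤ.* d ℤ.+ e) ≡ a ℤ.* (b ℤ.* c ℤ.+ d) ℤ.+ e
    regroup = ℤ-Solver.solve-∀

  const-⊛ : ∀ c f n → (const c ⊛ f) n ≡ c ℤ.* f n
  const-⊛ c f zero    = ≡.refl
  const-⊛ c f (suc n) = ≡.trans (≡.cong (λ z → c ℤ.* f (suc n) ℤ.+ z) (⊛-zeroˡ _ (λ _ → ≡.refl) f n)) (ℤₚ.+-identityʳ _)

  ⊛-identityˡ : ∀ f n → (const (+ 1) ⊛ f) n ≡ f n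
  ⊛-identityˡ f n = ≡.trans (const-⊛ (+ 1) f n) (ℤₚ.*-identityˡ (f n))

  X-⊛ : ∀ f n → (X ⊛ f) (suc n) ≡ f n
  X-⊛ f n = ≡.trans (ℤₚ.+-identityˡ _) (⊛-identityˡ f n)

  seriesRing : CommutativeRing _ _
  seriesRing = record
    { Carrier = Series
    ; _≈_ = λ f g → ∀ n → f n ≡ g n
    ; _+_ = _⊕_
    ; _*_ = _⊛_
    ; -_ = ⊖_
    ; 0# = λ _ → + 0
    ; 1# = const (+ 1)
    ; isCommutativeRing = record
      { isRing = record
        { +-isAbelianGroup = record
          { isGroup = record
            { isMonoid = record
              { isSemigroup = record
                { isMagma = record
                  { isEquivalence = record
                    { refl = λ _ → ≡.refl ; sym = λ eq n → ≡.sym (eq n) ; trans = λ eq eq′ n → ≡.trans (eq n) (eq′ n) }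
                  ; ∙-cong = λ eq eq′ n → ≡.cong₂ ℤ._+_ (eq n) (eq′ n) }
                ; assoc = λ f g h n → ℤₚ.+-assoc (f n) (g n) (h n) }
              ; identity = (λ f n → ℤₚ.+-identityˡ (f n)) , (λ f n → ℤₚ.+-identityʳ (f n)) }
            ; inverse = (λ f n → ℤₚ.+-inverseˡ (f n)) , (λ f n → ℤₚ.+-inverseʳ (f n))
            ; ⁻¹-cong = λ eq n → ≡.cong ℤ.-_ (eq n) }
          ; comm = λ f g n → ℤₚ.+-comm (f n) (g n) }
        ; *-cong = ⊛-cong
        ; *-assoc = ⊛-assoc
        ; *-identity = ⊛-identityˡ , (λ f n → ≡.trans (⊛-comm f (const (+ 1)) n) (⊛-identityˡ f n))
        ; distrib = (λ f g h n → ≡.trans (⊛-comm f (g ⊕ h) n) (≡.trans (⊛-distribʳ f g h n)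
                       (≡.cong₂ ℤ._+_ (⊛-comm g f n) (⊛-comm h f n))))
                  , ⊛-distribʳ }
      ; *-comm = ⊛-comm } }

  -- f is a polynomial of degree at most d whose coefficient in degree d is c.
  Top : ℕ → Series → ℤ → Set
  Top d f c = f d ≡ c × (∀ {k} → d ℕ.< k → f k ≡ + 0)

  Top-⊕ : ∀ {d f g b c} → Top d f b → Top d g c → Top d (f ⊕ g) (b ℤ.+ c)
  Top-⊕ (f≡ , f0) (g≡ , g0) = ≡.cong₂ ℤ._+_ f≡ g≡ , λ d<k → ≡.cong₂ ℤ._+_ (f0 d<k) (g0 d<k)

  -- Above the degree of `g` the term with `f 0` vanishes, so `f` may be shifted down until it is a
  -- constant.
  Top-⊛ : ∀ d {e f g b c} → Top d f b → Top e g c → Top (d ℕ.+ e) (f ⊛ g) (b ℤ.* c)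
  Top-⊛ zero    {e} {f} {g} {b} {c} (f≡ , f0) (g≡ , g0) =
    ≡.trans (scalar e) (≡.cong (b ℤ.*_) g≡) ,
    λ {k} e<k → ≡.trans (scalar k) (≡.trans (≡.cong (b ℤ.*_) (g0 e<k)) (ℤₚ.*-zeroʳ b))
    where
    scalar : ∀ k → (f ⊛ g) k ≡ b ℤ.* g k
    scalar k = ≡.trans (⊛-cong (λ { zero → f≡ ; (suc n) → f0 (s≤s z≤n) }) (λ _ → ≡.refl) k) (const-⊛ b g k)
  Top-⊛ (suc d) {e} {f} {g} {b} {c} (f≡ , f0) (g≡ , g0) =
    ≡.trans (leading (d ℕ.+ e) (s≤s (ℕₚ.m≤n+m e d))) (proj₁ rest) ,
    λ { {suc k} (s≤s d+e<k) → ≡.trans (leading k (s≤s (ℕₚ.≤-trans (ℕₚ.m≤n+m e d) (ℕₚ.<⇒≤ d+e<k)))) (proj₂ rest d+e<k) }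
    where
    rest : Top (d ℕ.+ e) ((f ∘ suc) ⊛ g) (b ℤ.* c)
    rest = Top-⊛ d (f≡ , λ d<k → f0 (s≤s d<k)) (g≡ , g0)
    leading : ∀ k → e ℕ.< suc k → (f ⊛ g) (suc k) ≡ ((f ∘ suc) ⊛ g) k
    leading k e<k = ≡.trans (≡.cong (λ z → f 0 ℤ.* z ℤ.+ ((f ∘ suc) ⊛ g) k) (g0 e<k))
      (≡.trans (≡.cong (ℤ._+ ((f ∘ suc) ⊛ g) k) (ℤₚ.*-zeroʳ (f 0))) (ℤₚ.+-identityˡ _))

  Top-const : ∀ c → Top 0 (const c) c
  Top-const c = ≡.refl , λ { (s≤s _) → ≡.refl }

  -- Regards a constant as having degree at most 1, so that the summand 1 of 1 + X F contributes 0
  -- to the leading coefficient.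
  Top-const₁ : ∀ c → Top 1 (const c) (+ 0)
  Top-const₁ c = ≡.refl , λ { (s≤s _) → ≡.refl }

  Top-X : Top 1 X (+ 1)
  Top-X = ≡.refl , λ { (s≤s (s≤s _)) → ≡.refl }

-- From the truncated series ring to integer group determinants

module GroupDeterminantCongruence
  {n} {_∙_ : Fin n → Fin n → Fin n} {ε : Fin n} {_⁻¹ : Fin n → Fin n} (isGroup : IsGroup _≡_ _∙_ ε _⁻¹)
  where

  open PowerSeries
  open CommutativeRing seriesRing using (semiring)
  open Algebra.Properties.Semiring.Exp semiring using () renaming (_^_ to _^ₛ_)
  open Algebra.Properties.Semiring.Mult semiring using () renaming (_×_ to _·ₛ_)

  -- ℤ[[X]] / (n , Xⁿ⁺¹)
  Q : CommutativeRing _ _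
  Q = Quotient.quotientRing seriesRing (n ·ₛ const (+ 1)) (X ^ₛ suc n)

  open CommutativeRing Q using (0#; 1#; _≈_) renaming (semiring to Q-semiring)
  open Algebra.Properties.Semiring.Exp Q-semiring using (_^_)
  open Algebra.Properties.Semiring.Mult Q-semiring using () renaming (_×_ to _·_)
  open Algebra.Properties.Semiring.Sum Q-semiring using (sum)
  open Determinant Q
  open GroupDeterminant Q isGroup

  Top-sum : ∀ {m} d {f : Fin m → Series} {c} → (∀ i → Top d (f i) (c i)) → Top d (sum f) (sumFin m c)
  Top-sum {zero}  d top = ≡.refl , λ _ → ≡.refl
  Top-sum {suc m} d top = Top-⊕ (top zero) (Top-sum d (top ∘ suc))

  Top-^ : ∀ {f c} m → Top 1 f c → Top m (f ^ m) (c ℤ.^ m)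
  Top-^ zero    top = Top-const (+ 1)
  Top-^ (suc m) top = Top-⊛ 1 top (Top-^ m top)

  Top-sgn : ∀ j → Top 0 (sgn j) ((ℤ.- + 1) ℤ.^ j)
  Top-sgn zero    = Top-const (+ 1)
  Top-sgn (suc j) = Top-⊛ 0 (≡.refl , λ { (s≤s _) → ≡.refl }) (Top-sgn j)

  -- Each term of the expansion takes one entry per row, so degree m is reached only by the linear
  -- coefficients of all m entries.
  Top-Det : ∀ m {A : Matrix m} {B} → (∀ i j → Top 1 (A i j) (B i j)) → Top m (Det m A) (det m B)
  Top-Det zero    top = Top-const (+ 1)
  Top-Det (suc m) {A} {B} top = Top-sum (suc m) λ j →
    Top-⊛ 1 (Top-⊛ 0 (Top-sgn (toℕ j)) (top zero j)) (Top-Det m λ r k → top (suc r) (punchIn j k))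

  private
    -- The multiples over `Q` and over series are separate instances of one recursion; they agree
    -- since `Q` keeps the operations.
    ·-≡ : ∀ m → m · 1# ≡ m ·ₛ const (+ 1)
    ·-≡ zero    = ≡.refl
    ·-≡ (suc m) = ≡.cong (const (+ 1) ⊕_) (·-≡ m)

    ^-≡ : ∀ m → X ^ m ≡ X ^ₛ m
    ^-≡ zero    = ≡.refl
    ^-≡ (suc m) = ≡.cong (X ⊛_) (^-≡ m)

    module S = CommutativeRing seriesRing

    n≈0 : n · 1# ≈ 0#
    n≈0 = S.1# , S.0# , S.trans (S.reflexive (·-≡ n)) (S.sym (S.trans (S.+-identityˡ _)
      (S.trans (S.+-cong (S.*-identityʳ _) (S.zeroʳ (X ^ₛ suc n))) (S.+-identityʳ (n ·ₛ const (+ 1))))))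

    X^≈0 : X ^ suc n ≈ 0#
    X^≈0 = S.0# , S.1# , S.trans (S.reflexive (^-≡ (suc n))) (S.sym (S.trans (S.+-identityˡ _)
      (S.trans (S.+-cong (S.zeroʳ (n ·ₛ const (+ 1))) (S.*-identityʳ _)) (S.+-identityˡ (X ^ₛ suc n)))))

    X^-low : ∀ m f {k} → k ℕ.< m → (X ^ₛ m ⊛ f) k ≡ + 0
    X^-low (suc m) f {zero}  _         = ≡.trans (⊛-assoc X (X ^ₛ m) f 0) ≡.refl
    X^-low (suc m) f {suc k} (s≤s k<m) = ≡.trans (⊛-assoc X (X ^ₛ m) f (suc k))
      (≡.trans (X-⊛ (X ^ₛ m ⊛ f) k) (X^-low m f k<m))

    ·-⊛ : ∀ m f k → ((m ·ₛ const (+ 1)) ⊛ f) k ≡ + m ℤ.* f k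
    ·-⊛ zero    f k = ⊛-zeroˡ _ (λ _ → ≡.refl) f k
    ·-⊛ (suc m) f k = ≡.trans (⊛-distribʳ f (const (+ 1)) (m ·ₛ const (+ 1)) k)
      (≡.trans (≡.cong₂ ℤ._+_ (⊛-identityˡ f k) (·-⊛ m f k)) (≡.sym (ℤₚ.suc-* (+ m) (f k))))

    Top-δ : ∀ x → Top 1 (δ x) (+ 0)
    Top-δ x with does (x Finₚ.≟ ε)
    ... | Bool.true  = Top-const₁ (+ 1)
    ... | Bool.false = ≡.refl , λ _ → ≡.refl

  module _ {q} (p-prime : Prime (suc q)) (h : ℕ) (q≡2h : q ≡ h ℕ.* 2) (e : ℕ)
    (order : n ≡ suc q ℕ.^ suc e) (exponent : ∀ g → PrimeExponent._·_ isGroup (suc q) g ≡ ε)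
    where

    group-determinant-congruence : ∀ (F : Fin n → ℤ) →
      + n ∣ det n (λ r s → F (r ∙ (s ⁻¹))) ℤ.- sumFin n F ℤ.^ n
    group-determinant-congruence F = coefficient
      (group-determinant p-prime h q≡2h e order n≈0 exponent X (suc n) X^≈0 (s≤s z≤n) (const ∘ F))
      where
      top : ∀ x → Top 1 (δ x ⊕ X ⊛ const (F x)) (F x)
      top x = ≡.subst (Top 1 _) (≡.trans (ℤₚ.+-identityˡ _) (ℤₚ.*-identityˡ (F x)))
        (Top-⊕ (Top-δ x) (Top-⊛ 1 Top-X (Top-const (F x))))
      coefficient : Det n (convolutionMatrix (λ x → δ x ⊕ X ⊛ const (F x))) ≈ sum (λ x → δ x ⊕ X ⊛ const (F x)) ^ n →
                    + n ∣ det n (λ r s → F (r ∙ (s ⁻¹))) ℤ.- sumFin n F ℤ.^ n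
      -- `eq` is an equation of series, used in degree n: the multiple of X^(n+1) does not reach
      -- that degree, and the multiple of n contributes `+ n ℤ.* u n`.
      coefficient (u , v , eq) = Signed.∣⇒∣ᵤ (Signed.divides (u n) (begin
        D ℤ.- S^n
          ≡⟨ ≡.cong (ℤ._- S^n) (≡.trans (≡.sym (proj₁ (Top-Det n (λ r s → top (r ∙ (s ⁻¹)))))) (eq n)) ⟩
        Σ^n ℤ.+ (((n ·ₛ const (+ 1)) ⊛ u) n ℤ.+ (X ^ₛ suc n ⊛ v) n) ℤ.- S^n
          ≡⟨ ≡.cong₂ (λ y z → y ℤ.+ z ℤ.- S^n) (proj₁ (Top-^ n (Top-sum 1 top)))
               (≡.cong₂ ℤ._+_ (·-⊛ n u n) (X^-low (suc n) v ℕₚ.≤-refl)) ⟩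
        S^n ℤ.+ (+ n ℤ.* u n ℤ.+ + 0) ℤ.- S^n
          ≡⟨ regroup S^n (+ n) (u n) ⟩
        u n ℤ.* + n ∎))
        where
        open ≡.≡-Reasoning
        D = det n (λ r s → F (r ∙ (s ⁻¹)))
        S^n = sumFin n F ℤ.^ n
        Σ^n = (sum (λ x → δ x ⊕ X ⊛ const (F x)) ^ n) n
        regroup : ∀ s m u → s ℤ.+ (m ℤ.* u ℤ.+ + 0) ℤ.- s ≡ u ℤ.* m
        regroup = ℤ-Solver.solve-∀

-- Reindexing integer sums and determinants

sumFin-cong : ∀ n {f g : Fin n → ℤ} → (∀ i → f i ≡ g i) → sumFin n f ≡ sumFin n g
sumFin-cong zero    f≡g = ≡.refl
sumFin-cong (suc n) f≡g = ≡.cong₂ ℤ._+_ (f≡g zero) (sumFin-cong n (f≡g ∘ suc))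

sumFin-++ : ∀ m n (f : Fin (m ℕ.+ n) → ℤ) →
            sumFin (m ℕ.+ n) f ≡ sumFin m (λ i → f (i ↑ˡ n)) ℤ.+ sumFin n (λ j → f (m ↑ʳ j))
sumFin-++ zero    n f = ≡.sym (ℤₚ.+-identityˡ _)
sumFin-++ (suc m) n f = ≡.trans (≡.cong (λ z → f zero ℤ.+ z) (sumFin-++ m n (f ∘ suc))) (≡.sym (ℤₚ.+-assoc (f zero) _ _))

sumFin-combine : ∀ m n (f : Fin (m ℕ.* n) → ℤ) →
                 sumFin (m ℕ.* n) f ≡ sumFin m (λ i → sumFin n (λ j → f (combine i j)))
sumFin-combine zero    n f = ≡.refl
sumFin-combine (suc m) n f = ≡.trans (sumFin-++ n (m ℕ.* n) f)
  (≡.cong (λ z → sumFin n (λ j → f (j ↑ˡ (m ℕ.* n))) ℤ.+ z) (sumFin-combine m n (λ j → f (n ↑ʳ j))))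

det-cong : ∀ n {A B : Fin n → Fin n → ℤ} → (∀ i j → A i j ≡ B i j) → det n A ≡ det n B
det-cong zero    A≡B = ≡.refl
det-cong (suc n) A≡B = sumFin-cong (suc n) λ j →
  ≡.cong₂ ℤ._*_ (≡.cong (((ℤ.- + 1) ℤ.^ toℕ j) ℤ.*_) (A≡B zero j)) (det-cong n λ r k → A≡B (suc r) (punchIn j k))

-- The Heisenberg group: group laws, exponent, coefficients

module Heisenberg (p : ℕ) .{{_ : ℕ.NonZero p}} where

  infix 4 _≋_

  _≋_ : ℕ → ℕ → Set
  m ≋ n = m % p ≡ n % p

  private
    ≋-+ : ∀ {m m′ n n′} → m ≋ m′ → n ≋ n′ → m ℕ.+ n ≋ m′ ℕ.+ n′
    ≋-+ {m} {m′} {n} {n′} eq eq′ = ≡.trans (%-distribˡ-+ m n p)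
      (≡.trans (≡.cong₂ (λ x y → (x ℕ.+ y) % p) eq eq′) (≡.sym (%-distribˡ-+ m′ n′ p)))

    ≋-* : ∀ {m m′ n n′} → m ≋ m′ → n ≋ n′ → m ℕ.* n ≋ m′ ℕ.* n′
    ≋-* {m} {m′} {n} {n′} eq eq′ = ≡.trans (%-distribˡ-* m n p)
      (≡.trans (≡.cong₂ (λ x y → (x ℕ.* y) % p) eq eq′) (≡.sym (%-distribˡ-* m′ n′ p)))

    ≋-refl : ∀ {m} → m ≋ m
    ≋-refl = ≡.refl

    toℕ-mod : ∀ m → toℕ (m mod p) ≋ m
    toℕ-mod m = ≡.trans (≡.cong (_% p) (Finₚ.toℕ-fromℕ< (m%n<n m p))) (m%n%n≡m%n m p)

    mod-cong : ∀ {m n} → m ≋ n → m mod p ≡ n mod p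
    mod-cong {m} {n} eq = Finₚ.toℕ-injective (≡.trans (Finₚ.toℕ-fromℕ< (m%n<n m p))
      (≡.trans eq (≡.sym (Finₚ.toℕ-fromℕ< (m%n<n n p)))))

    mod-toℕ : ∀ {m} (a : Fin p) → m ≋ toℕ a → m mod p ≡ a
    mod-toℕ {m} a eq = Finₚ.toℕ-injective (≡.trans (Finₚ.toℕ-fromℕ< (m%n<n m p))
      (≡.trans eq (m<n⇒m%n≡m (Finₚ.toℕ<n a))))

    multiple≋0 : ∀ m k → m ≡ k ℕ.* p → m ≋ 0
    multiple≋0 m k ≡.refl = ≡.trans (m*n%n≡0 k p) (≡.sym (m*n%n≡0 0 p))

    complement : ∀ (a : Fin p) → toℕ a ℕ.+ (p ℕ.∸ toℕ a) ≡ p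
    complement a = ℕₚ.m+[n∸m]≡n (ℕₚ.<⇒≤ (Finₚ.toℕ<n a))

    pair : ∀ {a a′ b b′ c c′ : Fin p} → a ≡ a′ → b ≡ b′ → c ≡ c′ → _≡_ {A = H p} (a , b , c) (a′ , b′ , c′)
    pair ≡.refl ≡.refl ≡.refl = ≡.refl

  e : H p
  e = 0 mod p , 0 mod p , 0 mod p

  mulH-assoc : ∀ x y z → mulH p (mulH p x y) z ≡ mulH p x (mulH p y z)
  mulH-assoc (a , b , c) (a′ , b′ , c′) (a″ , b″ , c″) = pair (additive a a′ a″) (additive b b′ b″)
    (mod-cong (≡.trans
      (≋-+ (≋-+ (toℕ-mod (toℕ c ℕ.+ toℕ c′ ℕ.+ toℕ b ℕ.* toℕ a′)) (≋-refl {toℕ c″}))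
           (≋-* (toℕ-mod (toℕ b ℕ.+ toℕ b′)) (≋-refl {toℕ a″})))
      (≡.trans (≡.cong (_% p) (central (toℕ b) (toℕ c) (toℕ a′) (toℕ b′) (toℕ c′) (toℕ a″) (toℕ c″)))
      (≡.sym (≋-+ (≋-+ (≋-refl {toℕ c}) (toℕ-mod (toℕ c′ ℕ.+ toℕ c″ ℕ.+ toℕ b′ ℕ.* toℕ a″)))
                  (≋-* (≋-refl {toℕ b}) (toℕ-mod (toℕ a′ ℕ.+ toℕ a″))))))))
    where
    additive : ∀ (a a′ a″ : Fin p) → (toℕ ((toℕ a ℕ.+ toℕ a′) mod p) ℕ.+ toℕ a″) mod p ≡
                                     (toℕ a ℕ.+ toℕ ((toℕ a′ ℕ.+ toℕ a″) mod p)) mod p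
    additive a a′ a″ = mod-cong (≡.trans (≋-+ (toℕ-mod (toℕ a ℕ.+ toℕ a′)) (≋-refl {toℕ a″}))
      (≡.trans (≡.cong (_% p) (ℕₚ.+-assoc (toℕ a) (toℕ a′) (toℕ a″)))
      (≡.sym (≋-+ (≋-refl {toℕ a}) (toℕ-mod (toℕ a′ ℕ.+ toℕ a″))))))
    central : ∀ b c a′ b′ c′ a″ c″ → c ℕ.+ c′ ℕ.+ b ℕ.* a′ ℕ.+ c″ ℕ.+ (b ℕ.+ b′) ℕ.* a″ ≡
                                     c ℕ.+ (c′ ℕ.+ c″ ℕ.+ b′ ℕ.* a″) ℕ.+ b ℕ.* (a′ ℕ.+ a″)
    central = ℕ-Solver.solve-∀

  mulH-identityˡ : ∀ x → mulH p e x ≡ x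
  mulH-identityˡ (a , b , c) = pair (additive a) (additive b) (mod-toℕ c (≡.trans
    (≋-+ (≋-+ (toℕ-mod 0) (≋-refl {toℕ c})) (≋-* (toℕ-mod 0) (≋-refl {toℕ a})))
    (≡.cong (_% p) (ℕₚ.+-identityʳ (toℕ c)))))
    where
    additive : ∀ (a : Fin p) → (toℕ (0 mod p) ℕ.+ toℕ a) mod p ≡ a
    additive a = mod-toℕ a (≋-+ (toℕ-mod 0) (≋-refl {toℕ a}))

  mulH-identityʳ : ∀ x → mulH p x e ≡ x
  mulH-identityʳ (a , b , c) = pair (additive a) (additive b) (mod-toℕ c (≡.trans
    (≋-+ (≋-+ (≋-refl {toℕ c}) (toℕ-mod 0)) (≋-* (≋-refl {toℕ b}) (toℕ-mod 0)))
    (≡.cong (_% p) (simplify (toℕ b) (toℕ c)))))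
    where
    additive : ∀ (a : Fin p) → (toℕ a ℕ.+ toℕ (0 mod p)) mod p ≡ a
    additive a = mod-toℕ a (≡.trans (≋-+ (≋-refl {toℕ a}) (toℕ-mod 0)) (≡.cong (_% p) (ℕₚ.+-identityʳ (toℕ a))))
    simplify : ∀ b c → c ℕ.+ 0 ℕ.+ b ℕ.* 0 ≡ c
    simplify = ℕ-Solver.solve-∀

  mulH-inverseʳ : ∀ x → mulH p x (invH p x) ≡ e
  mulH-inverseʳ (a , b , c) = pair (additive a) (additive b) (mod-cong (≡.trans
    (≋-+ (≋-+ (≋-refl {toℕ c}) (toℕ-mod (toℕ a ℕ.* toℕ b ℕ.+ (p ℕ.∸ toℕ c)))) (≋-* (≋-refl {toℕ b}) (toℕ-mod (p ℕ.∸ toℕ a))))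
    -- The central coordinate is c + (ab + (p - c)) + b (p - a) = (1 + b) p; for the left inverse it
    -- is (1 + a) p.
    (multiple≋0 _ (suc (toℕ b)) (≡.trans (regroup (toℕ a) (toℕ b) (toℕ c) (p ℕ.∸ toℕ a) (p ℕ.∸ toℕ c))
      (≡.cong₂ (λ x y → x ℕ.+ toℕ b ℕ.* y) (complement c) (complement a))))))
    where
    additive : ∀ (a : Fin p) → (toℕ a ℕ.+ toℕ (negMod p a)) mod p ≡ 0 mod p
    additive a = mod-cong (≡.trans (≋-+ (≋-refl {toℕ a}) (toℕ-mod (p ℕ.∸ toℕ a)))
      (multiple≋0 _ 1 (≡.trans (complement a) (≡.sym (ℕₚ.*-identityˡ p)))))
    regroup : ∀ a b c a′ c′ → c ℕ.+ (a ℕ.* b ℕ.+ c′) ℕ.+ b ℕ.* a′ ≡ (c ℕ.+ c′) ℕ.+ b ℕ.* (a ℕ.+ a′)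
    regroup = ℕ-Solver.solve-∀

  mulH-inverseˡ : ∀ x → mulH p (invH p x) x ≡ e
  mulH-inverseˡ (a , b , c) = pair (additive a) (additive b) (mod-cong (≡.trans
    (≋-+ (≋-+ (toℕ-mod (toℕ a ℕ.* toℕ b ℕ.+ (p ℕ.∸ toℕ c))) (≋-refl {toℕ c})) (≋-* (toℕ-mod (p ℕ.∸ toℕ b)) (≋-refl {toℕ a})))
    (multiple≋0 _ (suc (toℕ a)) (≡.trans (regroup (toℕ a) (toℕ b) (toℕ c) (p ℕ.∸ toℕ b) (p ℕ.∸ toℕ c))
      (≡.cong₂ (λ x y → x ℕ.+ toℕ a ℕ.* y) (complement c) (complement b))))))
    where
    additive : ∀ (a : Fin p) → (toℕ (negMod p a) ℕ.+ toℕ a) mod p ≡ 0 mod p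
    additive a = mod-cong (≡.trans (≋-+ (toℕ-mod (p ℕ.∸ toℕ a)) (≋-refl {toℕ a}))
      (multiple≋0 _ 1 (≡.trans (ℕₚ.+-comm (p ℕ.∸ toℕ a) (toℕ a)) (≡.trans (complement a) (≡.sym (ℕₚ.*-identityˡ p))))))
    regroup : ∀ a b c b′ c′ → a ℕ.* b ℕ.+ c′ ℕ.+ c ℕ.+ b′ ℕ.* a ≡ (c ℕ.+ c′) ℕ.+ a ℕ.* (b ℕ.+ b′)
    regroup = ℕ-Solver.solve-∀

  indexH : H p → Fin (p ℕ.* (p ℕ.* p))
  indexH (a , b , c) = combine a (combine b c)

  elemH-indexH : ∀ x → elemH p (indexH x) ≡ x
  elemH-indexH (a , b , c) = ≡.trans
    (≡.cong (λ (a , j) → a , remQuot {p} p j) (Finₚ.remQuot-combine {p} {p ℕ.* p} a (combine b c)))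
    (≡.cong (a ,_) (Finₚ.remQuot-combine {p} {p} b c))

  indexH-elemH : ∀ i → indexH (elemH p i) ≡ i
  indexH-elemH i = ≡.trans
    (≡.cong (combine (proj₁ (remQuot {p} (p ℕ.* p) i))) (Finₚ.combine-remQuot {p} p (proj₂ (remQuot {p} (p ℕ.* p) i))))
    (Finₚ.combine-remQuot {p} (p ℕ.* p) i)

  -- The group law is moved to matrix indices, where the general congruence is stated.
  _∙_ : Fin (p ℕ.* (p ℕ.* p)) → Fin (p ℕ.* (p ℕ.* p)) → Fin (p ℕ.* (p ℕ.* p))
  x ∙ y = indexH (mulH p (elemH p x) (elemH p y))

  _⁻¹ : Fin (p ℕ.* (p ℕ.* p)) → Fin (p ℕ.* (p ℕ.* p))
  x ⁻¹ = indexH (invH p (elemH p x))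

  private
    elemH-∙ : ∀ x y → elemH p (x ∙ y) ≡ mulH p (elemH p x) (elemH p y)
    elemH-∙ x y = elemH-indexH _

    elemH-injective : ∀ {x y} → elemH p x ≡ elemH p y → x ≡ y
    elemH-injective {x} {y} eq = ≡.trans (≡.sym (indexH-elemH x)) (≡.trans (≡.cong indexH eq) (indexH-elemH y))

  isGroup : IsGroup _≡_ _∙_ (indexH e) _⁻¹
  isGroup = record
    { isMonoid = record
      { isSemigroup = record
        { isMagma = record { isEquivalence = ≡.isEquivalence ; ∙-cong = ≡.cong₂ _∙_ }
        ; assoc = λ x y z → ≡.cong indexH (≡.trans (≡.cong (λ u → mulH p u (elemH p z)) (elemH-∙ x y))
            (≡.trans (mulH-assoc (elemH p x) (elemH p y) (elemH p z)) (≡.cong (mulH p (elemH p x)) (≡.sym (elemH-∙ y z))))) }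
      ; identity =
          (λ x → ≡.trans (≡.cong (λ u → indexH (mulH p u (elemH p x))) (elemH-indexH e))
                   (≡.trans (≡.cong indexH (mulH-identityˡ (elemH p x))) (indexH-elemH x)))
        , (λ x → ≡.trans (≡.cong (λ u → indexH (mulH p (elemH p x) u)) (elemH-indexH e))
                   (≡.trans (≡.cong indexH (mulH-identityʳ (elemH p x))) (indexH-elemH x))) }
    ; inverse =
        (λ x → ≡.cong indexH (≡.trans (≡.cong (λ u → mulH p u (elemH p x)) (elemH-indexH (invH p (elemH p x)))) (mulH-inverseˡ (elemH p x))))
      , (λ x → ≡.cong indexH (≡.trans (≡.cong (mulH p (elemH p x)) (elemH-indexH (invH p (elemH p x)))) (mulH-inverseʳ (elemH p x))))
    ; ⁻¹-cong = ≡.cong _⁻¹ }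

  -- j (j - 1) / 2 without division: the number of commutators collected in a j-th power.
  triangle : ℕ → ℕ
  triangle zero    = 0
  triangle (suc j) = triangle j ℕ.+ j

  triangle-odd : ∀ h → triangle (suc (h ℕ.* 2)) ≡ h ℕ.* suc (h ℕ.* 2)
  triangle-odd zero    = ≡.refl
  triangle-odd (suc h) = ≡.trans (≡.cong (λ z → z ℕ.+ suc (h ℕ.* 2) ℕ.+ suc (suc (h ℕ.* 2))) (triangle-odd h)) (step h)
    where
    step : ∀ h → h ℕ.* suc (h ℕ.* 2) ℕ.+ suc (h ℕ.* 2) ℕ.+ suc (suc (h ℕ.* 2)) ≡ suc h ℕ.* suc (suc (suc (h ℕ.* 2)))
    step = ℕ-Solver.solve-∀

  open PrimeExponent isGroup using (_·_)

  -- Multiplying the j-th power by x on the left moves y^b past x^(ja) and adds b (j a) to the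
  -- central coordinate; these add up to `triangle j` times a b.
  elemH-· : ∀ j x → let a , b , c = elemH p x in
    elemH p (j · x) ≡ ((j ℕ.* toℕ a) mod p , (j ℕ.* toℕ b) mod p , (j ℕ.* toℕ c ℕ.+ triangle j ℕ.* (toℕ a ℕ.* toℕ b)) mod p)
  elemH-· zero    x = elemH-indexH e
  elemH-· (suc j) x = ≡.trans (elemH-∙ x (j · x)) (≡.trans (≡.cong (mulH p (elemH p x)) (elemH-· j x))
    (pair (additive a) (additive b) (mod-cong (≡.trans
      (≋-+ (≋-+ (≋-refl {toℕ c}) (toℕ-mod (j ℕ.* toℕ c ℕ.+ triangle j ℕ.* (toℕ a ℕ.* toℕ b))))
           (≋-* (≋-refl {toℕ b}) (toℕ-mod (j ℕ.* toℕ a))))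
      (≡.cong (_% p) (central (toℕ a) (toℕ b) (toℕ c) j (triangle j)))))))
    where
    a = proj₁ (elemH p x)
    b = proj₁ (proj₂ (elemH p x))
    c = proj₂ (proj₂ (elemH p x))
    additive : ∀ (a : Fin p) → (toℕ a ℕ.+ toℕ ((j ℕ.* toℕ a) mod p)) mod p ≡ (suc j ℕ.* toℕ a) mod p
    additive a = mod-cong (≋-+ (≋-refl {toℕ a}) (toℕ-mod (j ℕ.* toℕ a)))
    central : ∀ a b c j t → c ℕ.+ (j ℕ.* c ℕ.+ t ℕ.* (a ℕ.* b)) ℕ.+ b ℕ.* (j ℕ.* a) ≡ suc j ℕ.* c ℕ.+ (t ℕ.+ j) ℕ.* (a ℕ.* b)
    central = ℕ-Solver.solve-∀

  exponent : ∀ h → p ≡ suc (h ℕ.* 2) → ∀ x → p · x ≡ indexH e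
  exponent h p≡2h+1 x = elemH-injective (≡.trans (elemH-· p x) (≡.trans
    -- With p = 2h + 1, `triangle p` is h p, so the central coordinate is (c + h a b) p.
    (pair (zero-mod a) (zero-mod b) (mod-cong (multiple≋0 _ (toℕ c ℕ.+ h ℕ.* (toℕ a ℕ.* toℕ b)) (≡.trans
      (≡.cong (λ t → p ℕ.* toℕ c ℕ.+ t ℕ.* (toℕ a ℕ.* toℕ b)) triangle-p)
      (regroup (toℕ c) h p (toℕ a ℕ.* toℕ b))))))
    (≡.sym (elemH-indexH e))))
    where
    a = proj₁ (elemH p x)
    b = proj₁ (proj₂ (elemH p x))
    c = proj₂ (proj₂ (elemH p x))
    zero-mod : ∀ (a : Fin p) → (p ℕ.* toℕ a) mod p ≡ 0 mod p
    zero-mod a = mod-cong (multiple≋0 _ (toℕ a) (ℕₚ.*-comm p (toℕ a)))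
    triangle-p : triangle p ≡ h ℕ.* p
    triangle-p = ≡.trans (≡.cong triangle p≡2h+1) (≡.trans (triangle-odd h) (≡.cong (h ℕ.*_) (≡.sym p≡2h+1)))
    regroup : ∀ c h p d → p ℕ.* c ℕ.+ h ℕ.* p ℕ.* d ≡ (c ℕ.+ h ℕ.* d) ℕ.* p
    regroup = ℕ-Solver.solve-∀

  module _ (coeff : Fin p → Fin p → Fin p → ℤ) where

    coefficient : Fin (p ℕ.* (p ℕ.* p)) → ℤ
    coefficient x = let i , j , k = elemH p x in coeff i j k

    groupMatrix-coefficient : ∀ r s → groupMatrix p coeff r s ≡ coefficient (r ∙ (s ⁻¹))
    groupMatrix-coefficient r s = ≡.sym (≡.cong (λ (i , j , k) → coeff i j k)
      (≡.trans (elemH-∙ r (s ⁻¹)) (≡.cong (mulH p (elemH p r)) (elemH-indexH (invH p (elemH p s))))))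

    sum-coefficient : sumFin (p ℕ.* (p ℕ.* p)) coefficient ≡ evalOne p coeff
    sum-coefficient = ≡.trans (sumFin-combine p (p ℕ.* p) coefficient) (sumFin-cong p λ i →
      ≡.trans (sumFin-combine p p (λ y → coefficient (combine i y))) (sumFin-cong p λ j → sumFin-cong p λ k →
        ≡.cong (λ (i , j , k) → coeff i j k) (elemH-indexH (i , j , k))))

-- The congruence for the Heisenberg group

prime≥3⇒odd : ∀ {p} → Prime p → 3 ℕ.≤ p → ∃ λ h → p ≡ suc (h ℕ.* 2)
prime≥3⇒odd {p} pr 3≤p = split (p % 2) (m%n<n p 2) (m≡m%n+[m/n]*n p 2)
  where
  split : ∀ r → r ℕ.< 2 → p ≡ r ℕ.+ p / 2 ℕ.* 2 → ∃ λ h → p ≡ suc (h ℕ.* 2)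
  split 1 _ eq = p / 2 , eq
  split 0 _ eq with prime⇒irreducible pr (divides (p / 2) eq)
  ... | inj₂ 2≡p = contradiction (≡.subst (3 ℕ.≤_) (≡.sym 2≡p) 3≤p) (ℕₚ.<-irrefl ≡.refl)
  split (suc (suc r)) (s≤s (s≤s ())) eq

open import Data.Nat using (_≤_; _^_)

theorem2 : (p : ℕ) (pr : Prime p) → 3 ≤ p → (a : Fin p → Fin p → Fin p → ℤ) →
    (+ (p ^ 3)) ∣ (groupDet p {{prime⇒nonZero pr}} a ℤ.- (evalOne p {{prime⇒nonZero pr}} a ℤ.^ (p ^ 3)))
theorem2 p pr 3≤p a with prime≥3⇒odd pr 3≤p
-- The match replaces p by `suc (h ℕ.* 2)`, which is the form `suc q` with `q` even that the general
-- congruence asks for.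
... | h , ≡.refl = ≡.subst (λ n → + n ∣ groupDet p a ℤ.- evalOne p a ℤ.^ n) order
  (≡.subst₂ (λ d s → + (p ℕ.* (p ℕ.* p)) ∣ d ℤ.- s ℤ.^ (p ℕ.* (p ℕ.* p)))
    (≡.sym (det-cong (p ℕ.* (p ℕ.* p)) (groupMatrix-coefficient a)))
    (sum-coefficient a)
    -- Here e is 2, as the order is p^(2+1).
    (group-determinant-congruence pr h ≡.refl 2 order (exponent h ≡.refl) (coefficient a)))
  where
  open Heisenberg p
  open GroupDeterminantCongruence isGroup
  order : p ℕ.* (p ℕ.* p) ≡ p ^ 3
  order = ≡.cong (λ z → p ℕ.* (p ℕ.* z)) (≡.sym (ℕₚ.*-identityʳ p))
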